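{- Consider $k$-MPMD on the metric space $(\mathbb R,d_{\mathrm D})$, where $d_{\mathrm D}(p_1,\ldots,p_k)=\max_{i,j}|p_i-p_j|$, and the algorithm GD-$k$ run with $\gamma=1$ and rate $r=1/k^2$. There exist instances $\sigma$ with $m$ requests for which GD-$k$ has competitive ratio $\Omega(m/k)$; precisely, there is an absolute constant $c>0$ such that for every $k\ge2$ and every $m$ that is a positive multiple of $k^2$, there is an instance $\sigma$ with $m$ requests with $\mathcal{OPT}(\sigma)>0$ on which the cost of GD-$k$'s output is at least $c\cdot\frac mk\cdot\mathcal{OPT}(\sigma)$.
   Context: $k$-MPMD on a $k$-point function $d_H:\chi^k\to[0,\infty)$ (here $\chi=\mathbb R$, $d_H=d_{\mathrm D}$): an instance $\sigma$ consists of requests $V=\{u_1,\ldots,u_m\}$ ($m$ a multiple of $k$) revealed online at arrival times $\mathrm{atime}(u_1)\le\cdots\le\mathrm{atime}(u_m)$, each with position $\mathrm{pos}(u_i)\in\chi$ revealed on arrival. At any time $\tau$ an online algorithm may irrevocably match a set $\{v_1,\ldots,v_k\}$ of $k$ arrived, not yet matched requests, at cost $d_H(\mathrm{pos}(v_1),\ldots,\mathrm{pos}(v_k))+\sum_{i=1}^k(\tau-\mathrm{atime}(v_i))$; all requests must be matched, and the algorithm's cost is the total. $\mathcal{OPT}(\sigma)$ is the minimum total cost achievable with full advance knowledge of $\sigma$. Notation: $E$ = unordered pairs of distinct requests; $\bar d(p,q):=d_H(p,q,\ldots,q)+d_H(q,p,\ldots,p)$; $\mathrm{opt\text{ - }cost}(\{u,w\}):=\bar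 d(\mathrm{pos}(u),\mathrm{pos}(w))+|\mathrm{atime}(u)-\mathrm{atime}(w)|$; $\delta(S)$ = pairs with exactly one endpoint in $S$. Algorithm GD-$k$ (with parameter $\gamma$ and rate $r$): it runs in continuous time and maintains a value $y_S\ge0$ for each set $S$ of arrived requests, a partition of the arrived requests into "active sets" ($A(v)$ denotes the active set containing $v$), a set of marked pairs, and a $k$-way matching $\mathcal M$ (initially empty). A request is free if it lies in no set of $\mathcal M$; $\mathrm{free}(S)$ is the set of free requests in $S$. When a request $v$ arrives: $A(v):=\{v\}$ and $y_S:=0$ for every set $S\ni v$. Whenever a pair $e=\{u,w\}$ of arrived requests with $A(u)\ne A(w)$ satisfies $\sum_{S:e\in\delta(S)}y_S=\frac{1}{\gamma k^2}\mathrm{opt\text{ - }cost}(e)$, the algorithm merges $A(u)$ and $A(w)$ into the single active set $S=A(u)\cup A(w)$ (the two old sets stop being active), marks $e$, and while $|\mathrm{free}(S)|\ge k$ it chooses an arbitrary set of $k$ requests from $\mathrm{free}(S)$ and matches it at the current time. At every moment, for every active set $S$ with $\mathrm{free}(S)\ne\emptyset$, $y_S$ increases continuously at rate $r$; all other $y_S$ stay constant.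
   Formalization: Positions, arrival times, the times at which the algorithm and the offline optimum match requests, the dual values and the growth steps are rational numbers instead of real numbers. -}

module Defs where

open import Data.Bool using (Bool; true; false; _∧_; _∨_; not; if_then_else_; _xor_)
open import Data.Nat as ℕ using (ℕ; zero; suc; _∸_)
open import Data.Fin using (Fin; toℕ; fromℕ<)
open import Data.Fin.Subset using (Subset; ⁅_⁆; _∪_; _∩_; ∁; ⊥) renaming (∣_∣ to #_)
open import Data.Vec as Vec using (Vec; []; _∷_; lookup)
open import Data.Vec.Properties using (≡-dec)
import Data.Bool.Properties as BoolP
open import Data.List as List using (List; []; _∷_; _++_; replicate; filter; allFin; length)
open import Data.Bool.ListAction using (any)
open import Data.List.Membership.Propositional using (_∈_)
open import Data.Integer using (+_)
open import Data.Rational using (ℚ; 0ℚ; 1ℚ; _+_; _*_; _-_; _≤_; _<_; _/_; _⊔_; ∣_∣)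
open import Data.Product using (Σ; ∃; ∃-syntax; _×_; _,_)
open import Relation.Nullary using (¬_; does)
open import Relation.Nullary.Decidable using (⌊_⌋)
open import Relation.Binary.PropositionalEquality using (_≡_; _≢_)
open import Relation.Binary.Construct.Closure.ReflexiveTransitive using (Star)

ℕtoℚ : ℕ → ℚ
ℕtoℚ n = + n / 1

-- 1/n for n ≥ 1 (value at 0 is irrelevant; only used with n ≥ 1)
recipℕ : ℕ → ℚ
recipℕ zero    = 0ℚ
recipℕ (suc n) = + 1 / suc n

sumℚ : List ℚ → ℚ
sumℚ = List.foldr _+_ 0ℚ

-- The k-point function d_D(p_1,…,p_k) = max_{i,j} |p_i - p_j| on ℝ
-- (points given as a list; here they are rationals)

dD : List ℚ → ℚ
dD ps = List.foldr _⊔_ 0ℚ (List.concatMap (λ p → List.map (λ q → ∣ p - q ∣) ps) ps)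

dH1 : ℕ → ℚ → ℚ → ℚ
dH1 k p q = dD (p ∷ replicate (k ∸ 1) q)

dbar : ℕ → ℚ → ℚ → ℚ
dbar k p q = dH1 k p q + dH1 k q p

record Instance (m : ℕ) : Set where
  field
    pos    : Fin m → ℚ
    atime  : Fin m → ℚ
    sorted : ∀ i j → toℕ i ℕ.≤ toℕ j → atime i ≤ atime j
open Instance public

optCost : ∀ {m} → ℕ → Instance m → Fin m → Fin m → ℚ
optCost k σ u w = dbar k (pos σ u) (pos σ w) + ∣ atime σ u - atime σ w ∣

elems : ∀ {m} → Subset m → List (Fin m)
elems {m} S = filter (λ v → lookup S v BoolP.≟ true) (allFin m)

allSubsets : ∀ n → List (Subset n)
allSubsets zero    = [] ∷ []
allSubsets (suc n) = List.map (true ∷_) (allSubsets n) ++ List.map (false ∷_) (allSubsets n)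

_==ˢ_ : ∀ {m} → Subset m → Subset m → Bool
S ==ˢ T = ⌊ ≡-dec BoolP._≟_ S T ⌋

inδ : ∀ {m} → Fin m → Fin m → Subset m → Bool
inδ u w S = lookup S u xor lookup S w

groupCost : ∀ {m} → Instance m → Subset m × ℚ → ℚ
groupCost σ (T , τ) =
  dD (List.map (pos σ) (elems T)) + sumℚ (List.map (λ v → τ - atime σ v) (elems T))

matchingCost : ∀ {m} → Instance m → List (Subset m × ℚ) → ℚ
matchingCost σ M = sumℚ (List.map (groupCost σ) M)

record OfflineSolution {m} (k : ℕ) (σ : Instance m) : Set where
  field
    groups     : List (Subset m × ℚ)
    sizeK      : ∀ {T τ} → (T , τ) ∈ groups → # T ≡ k
    afterArr   : ∀ {T τ} → (T , τ) ∈ groups → ∀ v → lookup T v ≡ true → atime σ v ≤ τ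
    partition  : ∀ v → length (filter (λ g → lookup (Data.Product.proj₁ g) v BoolP.≟ true) groups) ≡ 1

IsOPT : ∀ {m} → ℕ → Instance m → ℚ → Set
IsOPT k σ opt =
  (∃[ sol ] matchingCost σ (OfflineSolution.groups {k = k} {σ} sol) ≡ opt) ×
  (∀ (sol : OfflineSolution k σ) → opt ≤ matchingCost σ (OfflineSolution.groups sol))

record State (m : ℕ) : Set where
  field
    now     : ℚ
    nArr    : ℕ
    y       : Subset m → ℚ
    act     : Fin m → Subset m        -- A(v) (meaningful for arrived v)
    marked  : List (Fin m × Fin m)
    matched : List (Subset m × ℚ)
open State public

arrived : ∀ {m} → State m → Fin m → Bool
arrived s v = ⌊ suc (toℕ v) ℕ.≤? nArr s ⌋

matchedSet : ∀ {m} → List (Subset m × ℚ) → Subset m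
matchedSet = List.foldr (λ g A → Data.Product.proj₁ g ∪ A) ⊥

freeSet : ∀ {m} → State m → Subset m
freeSet s = ∁ (matchedSet (matched s))

isActive : ∀ {m} → State m → Subset m → Bool
isActive {m} s S = any (λ v → arrived s v ∧ (act s v ==ˢ S)) (allFin m)

grows : ∀ {m} → State m → Subset m → Bool
grows {m} s S = isActive s S ∧ any (lookup (S ∩ freeSet s)) (allFin m)

dualLoad : ∀ {m} → State m → Fin m → Fin m → ℚ
dualLoad {m} s u w = sumℚ (List.map (λ S → if inδ u w S then y s S else 0ℚ) (allSubsets m))

threshold : ∀ {m} → ℕ → ℕ → Instance m → Fin m → Fin m → ℚ
threshold γ k σ u w = recipℕ (γ ℕ.* k ℕ.* k) * optCost k σ u w

crossPair : ∀ {m} → State m → Fin m → Fin m → Set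
crossPair s u w = u ≢ w × arrived s u ≡ true × arrived s w ≡ true × act s u ≢ act s w

-- no active set has ≥ k free requests (the matching loop has finished)
settled : ∀ {m} → ℕ → State m → Set
settled k s = ∀ v → arrived s v ≡ true → # (act s v ∩ freeSet s) ℕ.< k

_==ᶠ_ : ∀ {m} → Fin m → Fin m → Bool
a ==ᶠ b = ⌊ a Data.Fin.≟ b ⌋

module GD {m : ℕ} (γ k : ℕ) (r : ℚ) (σ : Instance m) where

  initState : Fin m → State m
  initState v0 = record
    { now = atime σ v0 ; nArr = 0 ; y = λ _ → 0ℚ ; act = ⁅_⁆
    ; marked = [] ; matched = [] }

  data Step (s : State m) : State m → Set where
    arrive : (v : Fin m) → toℕ v ≡ nArr s → atime σ v ≡ now s → settled k s →
      Step s record s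
        { nArr = suc (nArr s)
        ; y    = λ S → if lookup S v then 0ℚ else y s S
        ; act  = λ u → if u ==ᶠ v then ⁅ v ⁆ else act s u }
    merge : (u w : Fin m) → crossPair s u w →
      dualLoad s u w ≡ threshold γ k σ u w → settled k s →
      Step s record s
        { act    = λ v → if lookup (act s u ∪ act s w) v
                           then act s u ∪ act s w else act s v
        ; marked = (u , w) ∷ marked s }
    match : (v : Fin m) → arrived s v ≡ true → (T : Subset m) →
      (∀ x → lookup T x ≡ true → lookup (act s v ∩ freeSet s) x ≡ true) →
      # T ≡ k →
      Step s record s { matched = matched s ++ ((T , now s) ∷ []) }
    -- continuous growth for time Δ > 0: allowed only when nothing is
    -- pending (no arrival before now+Δ, no tight cross pair, matching
    -- loop finished); every active S with free(S) ≠ ∅ grows at rate r;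
    -- no cross pair may exceed its threshold during the step
    advance : (Δ : ℚ) → 0ℚ < Δ → settled k s →
      (∀ v → toℕ v ≡ nArr s → now s + Δ ≤ atime σ v) →
      (∀ u w → crossPair s u w → ¬ (dualLoad s u w ≡ threshold γ k σ u w)) →
      let s' = record s
            { now = now s + Δ
            ; y   = λ S → if grows s S then y s S + r * Δ else y s S } in
      (∀ u w → crossPair s' u w → dualLoad s' u w ≤ threshold γ k σ u w) →
      Step s s'

  Complete : State m → Set
  Complete s = nArr s ≡ m × (∀ v → lookup (freeSet s) v ≡ false)

  FinalState : State m → Set
  FinalState s = ∃[ v0 ] (toℕ v0 ≡ 0 × Star Step (initState v0) s × Complete s)

  algCost : State m → ℚ
  algCost s = matchingCost σ (matched s)

module GDk {m : ℕ} (k : ℕ) (σ : Instance m) = GD {m} 1 k (recipℕ (k ℕ.* k)) σ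

{-# OPTIONS --safe #-}
module Submission where

-- Requests arrive in rows of k consecutive ones; the first of each row sits at
-- position 0 and the others at D.  The first request p₀ at 0 and the first
-- request q₀ at D arrive at time 0, all other requests of row b at D + 3^b.
-- Up to time D the sets of p₀ and q₀ grow until they touch.  A later request
-- at time t then needs at most t − D further growth to reach the anchor (p₀ or
-- q₀) at its own position, since the sets around the anchor have already
-- contributed D.  The arrival times grow so fast that this happens before the
-- next row arrives: whatever the algorithm chooses, it matches every row as one
-- group, at cost at least D, hence pays at least (m/k)·D.  Grouping requests at
-- equal positions costs only the waiting of p₀ and q₀ and a small remainder,
-- in total at most 3·D.

open import Defs
open import Level using (0ℓ)
open import Data.Bool using (Bool; true; false; if_then_else_; _∧_; _∨_)
import Data.Bool.Properties as Boolₚ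
open import Data.Bool.ListAction using (any)
open import Data.Nat using (ℕ; zero; suc; _≤_; _*_; _∸_; _^_; _/_; _%_; NonZero; z≤n; s≤s) renaming (_+_ to _+ℕ_; _<_ to _<ℕ_)
import Data.Nat as ℕ
import Data.Nat.Properties as ℕₚ
import Data.Nat.DivMod as DivMod
import Data.Nat.Divisibility as Div
import Data.Integer as ℤ
import Data.Integer.Properties as ℤₚ
open import Data.Fin as Fin using (Fin; toℕ; fromℕ<)
import Data.Fin.Properties as Finₚ
open import Data.Fin.Subset as Subset using (Subset; ⁅_⁆; _∪_; _∩_; ⊥; _⊆_) renaming (∣_∣ to #_; _∈_ to _∈ₛ_; _∉_ to _∉ₛ_; _-_ to _-ₛ_)
import Data.Fin.Subset.Properties as Subₚ
open import Data.Vec as Vec using (lookup)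
import Data.Vec.Properties as Vecₚ
open import Data.Rational using (ℚ; 0ℚ; 1ℚ) renaming
  (_<_ to _<ℚ_; _≤_ to _≤ℚ_; _*_ to _*ℚ_; _+_ to _+ℚ_; _-_ to _-ℚ_; ∣_∣ to ∣_∣ℚ; _⊔_ to _⊔ℚ_)
import Data.Rational as ℚ
import Data.Rational.Properties as ℚₚ
import Data.Rational.Unnormalised as ℚᵘ
import Data.Rational.Unnormalised.Properties as ℚᵘₚ
open import Data.List as List using (List; []; _∷_; _++_; allFin)
import Data.List.Properties as Listₚ
open import Data.List.Membership.Propositional using (_∈_; find; lose)
open import Data.List.Membership.Propositional.Properties using
  (∈-++⁻; ∈-++⁺ˡ; ∈-++⁺ʳ; ∈-map⁺; ∈-map⁻; ∈-filter⁺; ∈-filter⁻; ∈-allFin; ∈-upTo⁺; ∈-upTo⁻;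
   ∈-concatMap⁺; ∈-concatMap⁻; ∈-cartesianProduct⁺; ∈-cartesianProductWith⁺)
open import Data.List.Relation.Unary.Any using (here; there)
open import Data.List.Relation.Unary.All as All using (All; []; _∷_)
open import Data.List.Relation.Unary.Unique.Propositional using (Unique; []; _∷_)
import Data.List.Relation.Unary.Unique.Propositional.Properties as Uniqueₚ
open import Data.Product using (Σ; ∃; ∃-syntax; _×_; _,_; proj₁; proj₂)
open import Data.Sum using (_⊎_; inj₁; inj₂; [_,_]′)
open import Data.Empty using (⊥-elim) renaming (⊥ to Empty)
open import Function using (_∘_; case_of_)
open import Relation.Nullary using (¬_; contradiction; yes; no; Dec)
open import Relation.Nullary.Decidable using (⌊_⌋; _×-dec_; ¬?; dec⇒maybe)
open import Relation.Unary using (Decidable)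
open import Relation.Binary.PropositionalEquality using (_≡_; _≢_; refl; sym; trans; cong; cong₂; subst; subst₂; module ≡-Reasoning)
open import Relation.Binary.Construct.Closure.ReflexiveTransitive using (Star; ε; _◅_)
open import Tactic.RingSolver using (solve-∀)
open import Tactic.RingSolver.Core.AlmostCommutativeRing using (AlmostCommutativeRing; fromCommutativeRing)

-- Since γ = 1 and r = 1/k², every threshold is r times `optCost`, and a free request gains
-- potential at rate exactly r. Divided by r, the dual constraints become statements about elapsed
-- time. For a free request that arrived at t > D and is still separated from its anchor at time τ,
-- after the anchors have joined, the constraint reads (τ - t) + D ≤ t, that is τ ≤ 2t - D. With t =
-- D + 3^b the bound is D + 2·3^b, which lies below D + 3^(b+1); hence the base 3. The algorithm
-- chooses freely among tight pairs and among free requests, and members of a row may merge with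
-- each other before they reach an anchor. The proof therefore never describes a run: it keeps
-- bounds on potentials that every `Step` preserves and that leave only whole rows to be matched. A
-- bound over all final states is empty if there is none, so one run is followed to completion
-- separately; likewise OPT is shown to be attained. The number of rows is a multiple of k so that
-- the offline solution can cut each column into groups of k requests at equal positions.

ringℚ : AlmostCommutativeRing 0ℓ 0ℓ
ringℚ = fromCommutativeRing ℚₚ.+-*-commutativeRing (λ x → dec⇒maybe (0ℚ ℚₚ.≟ x))

-- Linear arithmetic by certificate: the equation says y - x = b - a and is left to the ring solver,
-- so a linear inequality is reduced to a known one.
≤-shift : ∀ {x y a b} → x +ℚ b ≡ y +ℚ a → a ≤ℚ b → x ≤ℚ y
≤-shift {x} {y} {a} {b} eq a≤b =
  subst₂ _≤ℚ_ (lem x a) (lem y a)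
    (ℚₚ.+-monoˡ-≤ (ℚ.- a) (subst (x +ℚ a ≤ℚ_) eq (ℚₚ.+-monoʳ-≤ x a≤b)))
  where
  lem : ∀ x a → (x +ℚ a) +ℚ (ℚ.- a) ≡ x
  lem = solve-∀ ringℚ

<-shift : ∀ {x y a b} → x +ℚ b ≡ y +ℚ a → a <ℚ b → x <ℚ y
<-shift {x} {y} {a} {b} eq a<b =
  subst₂ _<ℚ_ (lem x a) (lem y a)
    (ℚₚ.+-monoˡ-< (ℚ.- a) (subst (x +ℚ a <ℚ_) eq (ℚₚ.+-monoʳ-< x a<b)))
  where
  lem : ∀ x a → (x +ℚ a) +ℚ (ℚ.- a) ≡ x
  lem = solve-∀ ringℚ

<⇒≱ : ∀ {p q} → p <ℚ q → ¬ q ≤ℚ p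
<⇒≱ p<q q≤p = ℚₚ.<-irrefl refl (ℚₚ.<-≤-trans p<q q≤p)

p-0≡p : ∀ p → p -ℚ 0ℚ ≡ p
p-0≡p = solve-∀ ringℚ

p-q≥0 : ∀ {p q} → q ≤ℚ p → 0ℚ ≤ℚ p -ℚ q
p-q≥0 {p} {q} = ≤-shift (lem p q)
  where
  lem : ∀ p q → 0ℚ +ℚ p ≡ (p -ℚ q) +ℚ q
  lem = solve-∀ ringℚ

p-q>0 : ∀ {p q} → q <ℚ p → 0ℚ <ℚ p -ℚ q
p-q>0 {p} {q} = <-shift (lem p q)
  where
  lem : ∀ p q → 0ℚ +ℚ p ≡ (p -ℚ q) +ℚ q
  lem = solve-∀ ringℚ

x≤x+d : ∀ x {d} → 0ℚ ≤ℚ d → x ≤ℚ x +ℚ d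
x≤x+d x {d} = ≤-shift (lem x d)
  where
  lem : ∀ x d → x +ℚ d ≡ (x +ℚ d) +ℚ 0ℚ
  lem = solve-∀ ringℚ

x<x+d : ∀ x {d} → 0ℚ <ℚ d → x <ℚ x +ℚ d
x<x+d x {d} = <-shift (lem x d)
  where
  lem : ∀ x d → x +ℚ d ≡ (x +ℚ d) +ℚ 0ℚ
  lem = solve-∀ ringℚ

+-nonNeg : ∀ {p q} → 0ℚ ≤ℚ p → 0ℚ ≤ℚ q → 0ℚ ≤ℚ p +ℚ q
+-nonNeg {p} 0≤p 0≤q = ℚₚ.≤-trans 0≤p (x≤x+d p 0≤q)

*-monoˡ-≤ : ∀ {r p q} → 0ℚ ≤ℚ r → p ≤ℚ q → r *ℚ p ≤ℚ r *ℚ q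
*-monoˡ-≤ {r} 0≤r = ℚₚ.*-monoˡ-≤-nonNeg r {{ℚ.nonNegative 0≤r}}

*-cancelˡ-≤ : ∀ {r p q} → 0ℚ <ℚ r → r *ℚ p ≤ℚ r *ℚ q → p ≤ℚ q
*-cancelˡ-≤ {r} 0<r = ℚₚ.*-cancelˡ-≤-pos r {{ℚ.positive 0<r}}

*-nonNeg : ∀ {p q} → 0ℚ ≤ℚ p → 0ℚ ≤ℚ q → 0ℚ ≤ℚ p *ℚ q
*-nonNeg {p} {q} 0≤p 0≤q = subst (_≤ℚ p *ℚ q) (ℚₚ.*-zeroʳ p) (*-monoˡ-≤ 0≤p 0≤q)

*-pos : ∀ {p q} → 0ℚ <ℚ p → 0ℚ <ℚ q → 0ℚ <ℚ p *ℚ q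
*-pos {p} {q} 0<p 0<q = subst (_<ℚ p *ℚ q) (ℚₚ.*-zeroʳ p) (ℚₚ.*-monoʳ-<-pos p {{ℚ.positive 0<p}} 0<q)

∣p-q∣-comm : ∀ p q → ∣ p -ℚ q ∣ℚ ≡ ∣ q -ℚ p ∣ℚ
∣p-q∣-comm p q = trans (sym (ℚₚ.∣-p∣≡∣p∣ (p -ℚ q))) (cong ∣_∣ℚ (lem p q))
  where
  lem : ∀ p q → ℚ.- (p -ℚ q) ≡ q -ℚ p
  lem = solve-∀ ringℚ

∣p-p∣≡0 : ∀ p → ∣ p -ℚ p ∣ℚ ≡ 0ℚ
∣p-p∣≡0 p = cong ∣_∣ℚ (ℚₚ.+-inverseʳ p)

p≤∣p∣ : ∀ p → p ≤ℚ ∣ p ∣ℚ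
p≤∣p∣ p with ℚₚ.≤-total 0ℚ p
... | inj₁ 0≤p = ℚₚ.≤-reflexive (sym (ℚₚ.0≤p⇒∣p∣≡p 0≤p))
... | inj₂ p≤0 = ℚₚ.≤-trans p≤0 (ℚₚ.0≤∣p∣ p)

-- Natural numbers and their reciprocals inside the rationals

/1-homo-+ : ∀ i j → (i ℤ.+ j) ℚ./ 1 ≡ (i ℚ./ 1) +ℚ (j ℚ./ 1)
/1-homo-+ i j = ℚₚ.toℚᵘ-injective (begin
  ℚ.toℚᵘ ((i ℤ.+ j) ℚ./ 1)              ≈⟨ ℚₚ.toℚᵘ-fromℚᵘ (ℚᵘ.mkℚᵘ (i ℤ.+ j) 0) ⟩
  ℚᵘ.mkℚᵘ (i ℤ.+ j) 0                   ≈⟨ ℚᵘ.*≡* (cong (ℤ._* ℤ.+ 1) (cong₂ ℤ._+_ (sym (ℤₚ.*-identityʳ i)) (sym (ℤₚ.*-identityʳ j)))) ⟩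
  ℚᵘ.mkℚᵘ i 0 ℚᵘ.+ ℚᵘ.mkℚᵘ j 0          ≈⟨ ℚᵘₚ.+-cong (ℚᵘₚ.≃-sym (ℚₚ.toℚᵘ-fromℚᵘ (ℚᵘ.mkℚᵘ i 0))) (ℚᵘₚ.≃-sym (ℚₚ.toℚᵘ-fromℚᵘ (ℚᵘ.mkℚᵘ j 0))) ⟩
  ℚ.toℚᵘ (i ℚ./ 1) ℚᵘ.+ ℚ.toℚᵘ (j ℚ./ 1) ≈⟨ ℚᵘₚ.≃-sym (ℚₚ.toℚᵘ-homo-+ (i ℚ./ 1) (j ℚ./ 1)) ⟩
  ℚ.toℚᵘ ((i ℚ./ 1) +ℚ (j ℚ./ 1))       ∎)
  where
  open ℚᵘₚ.≃-Reasoning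

ℕtoℚ-+ : ∀ a b → ℕtoℚ (a +ℕ b) ≡ ℕtoℚ a +ℚ ℕtoℚ b
ℕtoℚ-+ a b = /1-homo-+ (ℤ.+ a) (ℤ.+ b)

0≤ℕtoℚ : ∀ n → 0ℚ ≤ℚ ℕtoℚ n
0≤ℕtoℚ n = ℚₚ.nonNegative⁻¹ (ℕtoℚ n) {{ℚₚ.normalize-nonNeg n 1}}

0<ℕtoℚ : ∀ {n} → 0 <ℕ n → 0ℚ <ℚ ℕtoℚ n
0<ℕtoℚ {suc n} _ = ℚₚ.positive⁻¹ (ℕtoℚ (suc n)) {{ℚₚ.normalize-pos (suc n) 1}}

ℕtoℚ-suc : ∀ n → ℕtoℚ (suc n) ≡ 1ℚ +ℚ ℕtoℚ n
ℕtoℚ-suc = ℕtoℚ-+ 1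

ℕtoℚ-* : ∀ a b → ℕtoℚ (a * b) ≡ ℕtoℚ a *ℚ ℕtoℚ b
ℕtoℚ-* zero    b = sym (ℚₚ.*-zeroˡ (ℕtoℚ b))
ℕtoℚ-* (suc a) b = begin
  ℕtoℚ (b +ℕ a * b)              ≡⟨ ℕtoℚ-+ b (a * b) ⟩
  ℕtoℚ b +ℚ ℕtoℚ (a * b)         ≡⟨ cong (ℕtoℚ b +ℚ_) (ℕtoℚ-* a b) ⟩
  ℕtoℚ b +ℚ ℕtoℚ a *ℚ ℕtoℚ b     ≡⟨ lem (ℕtoℚ a) (ℕtoℚ b) ⟩
  (1ℚ +ℚ ℕtoℚ a) *ℚ ℕtoℚ b       ≡⟨ cong (_*ℚ ℕtoℚ b) (sym (ℕtoℚ-suc a)) ⟩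
  ℕtoℚ (suc a) *ℚ ℕtoℚ b         ∎
  where
  open ≡-Reasoning
  lem : ∀ x y → y +ℚ x *ℚ y ≡ (1ℚ +ℚ x) *ℚ y
  lem = solve-∀ ringℚ

ℕtoℚ-mono-≤ : ∀ {a b} → a ≤ b → ℕtoℚ a ≤ℚ ℕtoℚ b
ℕtoℚ-mono-≤ {a} {b} a≤b = subst (ℕtoℚ a ≤ℚ_)
  (trans (sym (ℕtoℚ-+ a (b ∸ a))) (cong ℕtoℚ (ℕₚ.m+[n∸m]≡n a≤b))) (x≤x+d (ℕtoℚ a) (0≤ℕtoℚ (b ∸ a)))

ℕtoℚ-mono-< : ∀ {a b} → a <ℕ b → ℕtoℚ a <ℚ ℕtoℚ b
ℕtoℚ-mono-< {a} {b} a<b = subst (ℕtoℚ a <ℚ_)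
  (trans (sym (ℕtoℚ-+ a (b ∸ a))) (cong ℕtoℚ (ℕₚ.m+[n∸m]≡n (ℕₚ.<⇒≤ a<b)))) (x<x+d (ℕtoℚ a) (0<ℕtoℚ {b ∸ a} (ℕₚ.m<n⇒0<n∸m a<b)))

recipℕ-pos : ∀ {n} → 0 <ℕ n → 0ℚ <ℚ recipℕ n
recipℕ-pos {suc n} _ = ℚₚ.positive⁻¹ (recipℕ (suc n)) {{ℚₚ.normalize-pos 1 (suc n)}}

ℕtoℚ*recipℕ : ∀ {n} → 0 <ℕ n → ℕtoℚ n *ℚ recipℕ n ≡ 1ℚ
ℕtoℚ*recipℕ {suc n} _ = ℚₚ.toℚᵘ-injective (begin
  ℚ.toℚᵘ (ℕtoℚ (suc n) *ℚ recipℕ (suc n))  ≈⟨ ℚₚ.toℚᵘ-homo-* (ℕtoℚ (suc n)) (recipℕ (suc n)) ⟩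
  ℚ.toℚᵘ (ℕtoℚ (suc n)) ℚᵘ.* ℚ.toℚᵘ (recipℕ (suc n))
    ≈⟨ ℚᵘₚ.*-cong (ℚₚ.toℚᵘ-fromℚᵘ (ℚᵘ.mkℚᵘ (ℤ.+ suc n) 0)) (ℚₚ.toℚᵘ-fromℚᵘ (ℚᵘ.mkℚᵘ (ℤ.+ 1) n)) ⟩
  ℚᵘ.mkℚᵘ (ℤ.+ suc n) 0 ℚᵘ.* ℚᵘ.mkℚᵘ (ℤ.+ 1) n
    ≈⟨ ℚᵘ.*≡* (trans (ℤₚ.*-identityʳ _) (trans (ℤₚ.*-identityʳ _) (trans (cong (ℤ.+_) (sym (ℕₚ.*-identityˡ (suc n)))) (sym (ℤₚ.*-identityˡ _))))) ⟩
  ℚ.toℚᵘ 1ℚ ∎)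
  where
  open ℚᵘₚ.≃-Reasoning

-- Finite sums of rationals

module _ {A : Set} where

  Σ[_]_ : List A → (A → ℚ) → ℚ
  Σ[ xs ] f = sumℚ (List.map f xs)

  Σ-cong : ∀ (xs : List A) {f g : A → ℚ} → (∀ x → f x ≡ g x) → Σ[ xs ] f ≡ Σ[ xs ] g
  Σ-cong []       f≗g = refl
  Σ-cong (x ∷ xs) f≗g = cong₂ _+ℚ_ (f≗g x) (Σ-cong xs f≗g)

  Σ-mono : ∀ (xs : List A) {f g : A → ℚ} → (∀ x → x ∈ xs → f x ≤ℚ g x) → Σ[ xs ] f ≤ℚ Σ[ xs ] g
  Σ-mono []       f≤g = ℚₚ.≤-refl
  Σ-mono (x ∷ xs) f≤g = ℚₚ.+-mono-≤ (f≤g x (here refl)) (Σ-mono xs (λ z z∈ → f≤g z (there z∈)))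

  Σ-zero : ∀ (xs : List A) → Σ[ xs ] (λ _ → 0ℚ) ≡ 0ℚ
  Σ-zero []       = refl
  Σ-zero (x ∷ xs) = trans (ℚₚ.+-identityˡ _) (Σ-zero xs)

  Σ-const : ∀ (xs : List A) c → Σ[ xs ] (λ _ → c) ≡ ℕtoℚ (List.length xs) *ℚ c
  Σ-const []       c = sym (ℚₚ.*-zeroˡ c)
  Σ-const (x ∷ xs) c = trans (cong (c +ℚ_) (Σ-const xs c))
    (trans (lem (ℕtoℚ (List.length xs)) c) (cong (_*ℚ c) (sym (ℕtoℚ-suc (List.length xs)))))
    where
    lem : ∀ n c → c +ℚ n *ℚ c ≡ (1ℚ +ℚ n) *ℚ c
    lem = solve-∀ ringℚ

  Σ-+ : ∀ (xs : List A) (f g : A → ℚ) → Σ[ xs ] (λ x → f x +ℚ g x) ≡ Σ[ xs ] f +ℚ Σ[ xs ] g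
  Σ-+ []       f g = refl
  Σ-+ (x ∷ xs) f g = trans (cong ((f x +ℚ g x) +ℚ_) (Σ-+ xs f g)) (lem (f x) (g x) _ _)
    where
    lem : ∀ a b c d → (a +ℚ b) +ℚ (c +ℚ d) ≡ (a +ℚ c) +ℚ (b +ℚ d)
    lem = solve-∀ ringℚ

  Σ-nonNeg : ∀ (xs : List A) {f : A → ℚ} → (∀ x → x ∈ xs → 0ℚ ≤ℚ f x) → 0ℚ ≤ℚ Σ[ xs ] f
  Σ-nonNeg xs {f} f≥0 = subst (_≤ℚ Σ[ xs ] f) (Σ-zero xs) (Σ-mono xs f≥0)

  Σ-term : ∀ {xs : List A} {f : A → ℚ} {x} → x ∈ xs → (∀ x → x ∈ xs → 0ℚ ≤ℚ f x) → f x ≤ℚ Σ[ xs ] f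
  Σ-term {f = f} {x} (here refl) f≥0 = x≤x+d (f x) (Σ-nonNeg _ (λ z z∈ → f≥0 z (there z∈)))
  Σ-term {y ∷ xs} {f} {x} (there x∈) f≥0 = ℚₚ.≤-trans (Σ-term x∈ (λ z z∈ → f≥0 z (there z∈)))
    (subst (Σ[ xs ] f ≤ℚ_) (ℚₚ.+-comm _ (f y)) (x≤x+d _ (f≥0 y (here refl))))

  Σ-vanish : ∀ (xs : List A) {f : A → ℚ} → (∀ x → x ∈ xs → f x ≡ 0ℚ) → Σ[ xs ] f ≡ 0ℚ
  Σ-vanish []       f≡0 = refl
  Σ-vanish (x ∷ xs) f≡0 = cong₂ _+ℚ_ (f≡0 x (here refl)) (Σ-vanish xs (λ z z∈ → f≡0 z (there z∈)))

  -- Isolates the one growing active set in a sum over all subsets, and later each of the two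
  -- anchors in the total waiting cost.
  Σ-single : ∀ {xs : List A} {x} {f : A → ℚ} → Unique xs → x ∈ xs → (∀ y → y ≢ x → f y ≡ 0ℚ) → Σ[ xs ] f ≡ f x
  Σ-single {x ∷ xs} {_} {f} (x∉ ∷ _) (here refl) f≡0 =
    trans (cong (f x +ℚ_) (Σ-vanish xs (λ z z∈ → f≡0 z (λ { refl → All.lookup x∉ z∈ refl })))) (ℚₚ.+-identityʳ (f x))
  Σ-single {y ∷ xs} {x} {f} (y∉ ∷ un) (there x∈) f≡0 =
    trans (cong₂ _+ℚ_ (f≡0 y (λ { refl → All.lookup y∉ x∈ refl })) (Σ-single un x∈ f≡0)) (ℚₚ.+-identityˡ (f x))

Σ-swap : ∀ {A B : Set} (xs : List A) (ys : List B) (f : A → B → ℚ) →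
  Σ[ xs ] (λ x → Σ[ ys ] f x) ≡ Σ[ ys ] (λ y → Σ[ xs ] (λ x → f x y))
Σ-swap []       ys f = sym (Σ-zero ys)
Σ-swap (x ∷ xs) ys f = trans (cong (Σ[ ys ] f x +ℚ_) (Σ-swap xs ys f)) (sym (Σ-+ ys (f x) _))

-- Finite subsets and lists

∈⇒lookup : ∀ {n x} {p : Subset n} → x ∈ₛ p → lookup p x ≡ true
∈⇒lookup = Vecₚ.[]=⇒lookup

lookup⇒∈ : ∀ {n x} {p : Subset n} → lookup p x ≡ true → x ∈ₛ p
lookup⇒∈ {x = x} {p} = Vecₚ.lookup⇒[]= x p

∉⇒lookup : ∀ {n x} {p : Subset n} → x ∉ₛ p → lookup p x ≡ false
∉⇒lookup x∉p = Boolₚ.¬-not (x∉p ∘ lookup⇒∈)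

lookup⇒∉ : ∀ {n x} {p : Subset n} → lookup p x ≡ false → x ∉ₛ p
lookup⇒∉ eq x∈p with trans (sym (∈⇒lookup x∈p)) eq
... | ()

∧-true : ∀ {a b} → a ∧ b ≡ true → a ≡ true × b ≡ true
∧-true {true} {true} _ = refl , refl

any⁺ : ∀ {A : Set} {p : A → Bool} {x} {xs : List A} → x ∈ xs → p x ≡ true → any p xs ≡ true
any⁺ {p = p} {xs = _ ∷ xs} (here refl) px = cong (_∨ any p xs) px
any⁺ {p = p} {xs = y ∷ xs} (there x∈) px = trans (cong (p y ∨_) (any⁺ {p = p} x∈ px)) (Boolₚ.∨-zeroʳ (p y))

any⁻ : ∀ {A : Set} {p : A → Bool} (xs : List A) → any p xs ≡ true → ∃ λ x → p x ≡ true
any⁻ {p = p} (x ∷ xs) eq with p x in px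
... | true  = x , px
... | false = any⁻ xs eq

==ˢ-refl : ∀ {m} (S : Subset m) → (S ==ˢ S) ≡ true
==ˢ-refl S with Vecₚ.≡-dec Boolₚ._≟_ S S
... | yes _ = refl
... | no  ¬p = contradiction refl ¬p

==ˢ⇒≡ : ∀ {m} {S T : Subset m} → (S ==ˢ T) ≡ true → S ≡ T
==ˢ⇒≡ {S = S} {T} eq with Vecₚ.≡-dec Boolₚ._≟_ S T
... | yes p = p

_≟ˢ_ : ∀ {m} (S T : Subset m) → Dec (S ≡ T)
_≟ˢ_ = Vecₚ.≡-dec Boolₚ._≟_

allSubsets-complete : ∀ {n} (S : Subset n) → S ∈ allSubsets n
allSubsets-complete Vec.[]              = here refl
allSubsets-complete (true  Vec.∷ S) = ∈-++⁺ˡ (∈-map⁺ (true Vec.∷_) (allSubsets-complete S))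
allSubsets-complete {suc n} (false Vec.∷ S) =
  ∈-++⁺ʳ (List.map (true Vec.∷_) (allSubsets n)) (∈-map⁺ (false Vec.∷_) (allSubsets-complete S))

allSubsets-unique : ∀ n → Unique (allSubsets n)
allSubsets-unique zero    = [] ∷ []
allSubsets-unique (suc n) = Uniqueₚ.++⁺
  (Uniqueₚ.map⁺ Vecₚ.∷-injectiveʳ (allSubsets-unique n))
  (Uniqueₚ.map⁺ Vecₚ.∷-injectiveʳ (allSubsets-unique n))
  λ { (in₁ , in₂) → disjoint in₁ in₂ }
  where
  disjoint : ∀ {v} → v ∈ List.map (true Vec.∷_) (allSubsets n) → v ∈ List.map (false Vec.∷_) (allSubsets n) → _
  disjoint in₁ in₂ with ∈-map⁻ (true Vec.∷_) in₁ | ∈-map⁻ (false Vec.∷_) in₂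
  ... | _ , _ , refl | _ , _ , ()

∣p∪q∣≤∣p∣+∣q∣ : ∀ {n} (p q : Subset n) → # (p ∪ q) ≤ # p +ℕ # q
∣p∪q∣≤∣p∣+∣q∣ Vec.[] Vec.[] = z≤n
∣p∪q∣≤∣p∣+∣q∣ (false Vec.∷ p) (false Vec.∷ q) = ∣p∪q∣≤∣p∣+∣q∣ p q
∣p∪q∣≤∣p∣+∣q∣ (false Vec.∷ p) (true  Vec.∷ q) = subst (suc (# (p ∪ q)) ≤_) (sym (ℕₚ.+-suc (# p) (# q))) (s≤s (∣p∪q∣≤∣p∣+∣q∣ p q))
∣p∪q∣≤∣p∣+∣q∣ (true  Vec.∷ p) (false Vec.∷ q) = s≤s (∣p∪q∣≤∣p∣+∣q∣ p q)
∣p∪q∣≤∣p∣+∣q∣ (true  Vec.∷ p) (true  Vec.∷ q) = s≤s (ℕₚ.≤-trans (∣p∪q∣≤∣p∣+∣q∣ p q) (ℕₚ.+-monoʳ-≤ (# p) (ℕₚ.n≤1+n (# q))))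

-- Together with `covered⇒∣∣≤` this determines a cardinality from an enumeration by `Fin k`; it is
-- applied to the rows and to the offline batches.
injective⇒≤∣∣ : ∀ {m} k (f : Fin k → Fin m) {T : Subset m} →
  (∀ {i j} → f i ≡ f j → i ≡ j) → (∀ i → f i ∈ₛ T) → k ≤ # T
injective⇒≤∣∣ zero    f inj f∈T = z≤n
injective⇒≤∣∣ (suc k) f {T} inj f∈T = ℕₚ.≤-<-trans
  (injective⇒≤∣∣ k (f ∘ Fin.suc) {T -ₛ f Fin.zero} (λ eq → suc-inj (inj eq))
    (λ i → Subₚ.x∈p∧x≢y⇒x∈p-y (f∈T (Fin.suc i)) (λ eq → suc≢0 (inj eq))))
  (Subₚ.x∈p⇒∣p-x∣<∣p∣ (f∈T Fin.zero))
  where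
  suc-inj : ∀ {i j : Fin k} → Fin.suc i ≡ Fin.suc j → i ≡ j
  suc-inj refl = refl
  suc≢0 : ∀ {i : Fin k} → Fin.suc i ≢ Fin.zero
  suc≢0 ()

covered⇒∣∣≤ : ∀ {m} k (f : Fin k → Fin m) {T : Subset m} →
  (∀ {x} → x ∈ₛ T → ∃ λ i → f i ≡ x) → # T ≤ k
covered⇒∣∣≤ {m} zero f {T} cov = subst (# T ≤_) (Subₚ.∣⊥∣≡0 m)
  (Subₚ.p⊆q⇒∣p∣≤∣q∣ {q = ⊥} λ x∈T → contradiction (proj₁ (cov x∈T)) λ ())
covered⇒∣∣≤ (suc k) f {T} cov = begin
  # T                             ≤⟨ Subₚ.p⊆q⇒∣p∣≤∣q∣ split ⟩
  # (⁅ x₀ ⁆ ∪ (T -ₛ x₀))          ≤⟨ ∣p∪q∣≤∣p∣+∣q∣ ⁅ x₀ ⁆ (T -ₛ x₀) ⟩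
  # ⁅ x₀ ⁆ +ℕ # (T -ₛ x₀)         ≡⟨ cong (_+ℕ # (T -ₛ x₀)) (Subₚ.∣⁅x⁆∣≡1 x₀) ⟩
  suc (# (T -ₛ x₀))               ≤⟨ s≤s (covered⇒∣∣≤ k (f ∘ Fin.suc) cov′) ⟩
  suc k                           ∎
  where
  open ℕₚ.≤-Reasoning
  x₀ = f Fin.zero
  split : T ⊆ ⁅ x₀ ⁆ ∪ (T -ₛ x₀)
  split {x} x∈T with x Fin.≟ x₀
  ... | yes refl = Subₚ.x∈p∪q⁺ (inj₁ (Subₚ.x∈⁅x⁆ x₀))
  ... | no  x≢   = Subₚ.x∈p∪q⁺ (inj₂ (Subₚ.x∈p∧x≢y⇒x∈p-y x∈T x≢))
  cov′ : ∀ {x} → x ∈ₛ T -ₛ x₀ → ∃ λ i → f (Fin.suc i) ≡ x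
  cov′ {x} x∈ with cov (Subₚ.p─q⊆p T ⁅ x₀ ⁆ x∈)
  -- Here `x` would be `x₀` itself, still present after its removal; removing it a second time would
  -- shrink a set that is already unchanged by it.
  ... | Fin.zero  , refl = contradiction (Subₚ.x∈p⇒∣p-x∣<∣p∣ x∈) (λ lt → ℕₚ.<-irrefl (cong #_ (Subₚ.p─q─q≡p─q T ⁅ x₀ ⁆)) lt)
  ... | Fin.suc i , eq   = i , eq

⊆∧∣∣≤⇒⊇ : ∀ {m} {p q : Subset m} → p ⊆ q → # q ≤ # p → q ⊆ p
⊆∧∣∣≤⇒⊇ {p = p} p⊆q q≤p {x} x∈q with x Subₚ.∈? p
... | yes x∈p = x∈p
... | no  x∉p = contradiction (Subₚ.p⊂q⇒∣p∣<∣q∣ (p⊆q , x , x∈q , x∉p)) (ℕₚ.≤⇒≯ q≤p)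

subset-of-size : ∀ {m} (S : Subset m) k → k ≤ # S → ∃ λ T → T ⊆ S × # T ≡ k
subset-of-size {m} S zero    _ = ⊥ , Subₚ.⊆-min S , Subₚ.∣⊥∣≡0 m
subset-of-size (false Vec.∷ S) (suc k) k≤ with subset-of-size S (suc k) k≤
... | T , T⊆S , eq = false Vec.∷ T , Subₚ.s⊆s T⊆S , eq
subset-of-size (true Vec.∷ S) (suc k) (s≤s k≤) with subset-of-size S k k≤
... | T , T⊆S , eq = true Vec.∷ T , Subₚ.s⊆s T⊆S , cong suc eq

second-member : ∀ {m} (T : Subset m) x → 2 ≤ # T → ∃ λ y → y ∈ₛ T × y ≢ x
second-member T x 2≤ with Subₚ.nonempty? (T -ₛ x)
... | yes (y , y∈) = y , Subₚ.p─q⊆p T ⁅ x ⁆ y∈ , λ { refl →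
      ℕₚ.<-irrefl (cong #_ (Subₚ.p─q─q≡p─q T ⁅ x ⁆)) (Subₚ.x∈p⇒∣p-x∣<∣p∣ y∈) }
... | no  empty = contradiction (ℕₚ.≤-trans 2≤ (ℕₚ.≤-trans (Subₚ.p⊆q⇒∣p∣≤∣q∣ T⊆⁅x⁆) (ℕₚ.≤-reflexive (Subₚ.∣⁅x⁆∣≡1 x)))) λ { (s≤s ()) }
  where
  T⊆⁅x⁆ : T ⊆ ⁅ x ⁆
  T⊆⁅x⁆ {y} y∈T with y Fin.≟ x
  ... | yes refl = Subₚ.x∈⁅x⁆ x
  ... | no  y≢x  = contradiction (y , Subₚ.x∈p∧x≢y⇒x∈p-y y∈T y≢x) empty

∣∣>0⇒nonempty : ∀ {m} (T : Subset m) → 1 ≤ # T → ∃ λ x → x ∈ₛ T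
∣∣>0⇒nonempty {m} T 1≤ with Subₚ.nonempty? T
... | yes ne = ne
... | no  ¬ne = contradiction (subst (1 ≤_) (trans (cong #_ (Subₚ.Empty-unique ¬ne)) (Subₚ.∣⊥∣≡0 m)) 1≤) λ ()

module _ {A : Set} {P Q : A → Set} (P? : Decidable P) (Q? : Decidable Q) (P⇒Q : ∀ x → P x → Q x) where

  count-mono : ∀ xs → List.length (List.filter P? xs) ≤ List.length (List.filter Q? xs)
  count-mono [] = z≤n
  count-mono (x ∷ xs) with P? x | Q? x
  ... | yes _ | yes _ = s≤s (count-mono xs)
  ... | yes p | no ¬q = contradiction (P⇒Q x p) ¬q
  ... | no  _ | yes _ = ℕₚ.m≤n⇒m≤1+n (count-mono xs)
  ... | no  _ | no  _ = count-mono xs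

  count-mono-< : ∀ {x xs} → x ∈ xs → ¬ P x → Q x → List.length (List.filter P? xs) <ℕ List.length (List.filter Q? xs)
  count-mono-< {x} {_ ∷ xs} (here refl) ¬p q with P? x | Q? x
  ... | yes p | _     = contradiction p ¬p
  ... | no  _ | yes _ = s≤s (count-mono xs)
  ... | no  _ | no ¬q = contradiction q ¬q
  count-mono-< {x} {y ∷ xs} (there x∈) ¬p q with P? y | Q? y
  ... | yes _ | yes _ = s≤s (count-mono-< x∈ ¬p q)
  ... | yes p | no ¬q = contradiction (P⇒Q y p) ¬q
  ... | no  _ | yes _ = ℕₚ.m≤n⇒m≤1+n (count-mono-< x∈ ¬p q)
  ... | no  _ | no  _ = count-mono-< x∈ ¬p q

∈-elems⁺ : ∀ {m} {S : Subset m} {v} → v ∈ₛ S → v ∈ elems S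
∈-elems⁺ {S = S} {v} v∈S = ∈-filter⁺ (λ v → lookup S v Boolₚ.≟ true) (∈-allFin v) (∈⇒lookup v∈S)

∈-elems⁻ : ∀ {m} {S : Subset m} {v} → v ∈ elems S → v ∈ₛ S
∈-elems⁻ {m} {S} {v} v∈ = lookup⇒∈ (proj₂ (∈-filter⁻ (λ v → lookup S v Boolₚ.≟ true) {xs = allFin m} v∈))

Σ-filter : ∀ {A : Set} (p : A → Bool) (f : A → ℚ) (xs : List A) →
  Σ[ List.filter (λ x → p x Boolₚ.≟ true) xs ] f ≡ Σ[ xs ] (λ x → if p x then f x else 0ℚ)
Σ-filter p f [] = refl
Σ-filter p f (x ∷ xs) with p x
... | true  = cong (f x +ℚ_) (Σ-filter p f xs)
... | false = trans (Σ-filter p f xs) (sym (ℚₚ.+-identityˡ _))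

fibre : ∀ {m} → (Fin m → ℕ) → ℕ → Subset m
fibre f b = Vec.tabulate (λ v → ⌊ f v ℕₚ.≟ b ⌋)

module _ {m} {f : Fin m → ℕ} {b : ℕ} {v : Fin m} where

  ∈-fibre⁺ : f v ≡ b → v ∈ₛ fibre f b
  ∈-fibre⁺ eq = lookup⇒∈ (trans (Vecₚ.lookup∘tabulate _ v) holds)
    where
    holds : ⌊ f v ℕₚ.≟ b ⌋ ≡ true
    holds with f v ℕₚ.≟ b
    ... | yes _  = refl
    ... | no neq = contradiction eq neq

  ∈-fibre⁻ : v ∈ₛ fibre f b → f v ≡ b
  ∈-fibre⁻ v∈ = sound (trans (sym (Vecₚ.lookup∘tabulate _ v)) (∈⇒lookup v∈))
    where
    sound : ⌊ f v ℕₚ.≟ b ⌋ ≡ true → f v ≡ b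
    sound eq with f v ℕₚ.≟ b
    ... | yes p = p

-- Invariants of the algorithm on an arbitrary instance

if-∈ : ∀ {A : Set} {n x} {p : Subset n} {a b : A} → x ∈ₛ p → (if lookup p x then a else b) ≡ a
if-∈ {a = a} {b} x∈p = cong (if_then a else b) (∈⇒lookup x∈p)

if-∉ : ∀ {A : Set} {n x} {p : Subset n} {a b : A} → x ∉ₛ p → (if lookup p x then a else b) ≡ b
if-∉ {a = a} {b} x∉p = cong (if_then a else b) (∉⇒lookup x∉p)

Arrived : ∀ {m} → State m → Fin m → Set
Arrived s v = toℕ v <ℕ nArr s

module _ {m} {s : State m} {v : Fin m} where

  arrived⁺ : Arrived s v → arrived s v ≡ true
  arrived⁺ a with suc (toℕ v) ℕ.≤? nArr s
  ... | yes _ = refl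
  ... | no ¬a = contradiction a ¬a

  arrived⁻ : arrived s v ≡ true → Arrived s v
  arrived⁻ eq with suc (toℕ v) ℕ.≤? nArr s
  ... | yes a = a

  isActive⁺ : arrived s v ≡ true → isActive s (act s v) ≡ true
  isActive⁺ a = any⁺ {p = λ w → arrived s w ∧ (act s w ==ˢ act s v)} (∈-allFin v)
    (cong₂ _∧_ a (==ˢ-refl (act s v)))

module _ {m} {s : State m} where

  isActive⁻ : ∀ {S} → isActive s S ≡ true → ∃ λ v → Arrived s v × S ≡ act s v
  isActive⁻ {S} eq with any⁻ {p = λ w → arrived s w ∧ (act s w ==ˢ S)} (allFin m) eq
  ... | v , both = v , arrived⁻ {s = s} (proj₁ (∧-true both)) , sym (==ˢ⇒≡ (proj₂ (∧-true both)))

  grows⁺ : ∀ {v u} → Arrived s v → u ∈ₛ act s v → u ∈ₛ freeSet s → grows s (act s v) ≡ true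
  grows⁺ {v} {u} a u∈ free = cong₂ _∧_ (isActive⁺ {s = s} (arrived⁺ {s = s} a))
    (any⁺ {p = lookup (act s v ∩ freeSet s)} (∈-allFin u) (∈⇒lookup (Subₚ.x∈p∩q⁺ (u∈ , free))))

  grows⁻ : ∀ {S} → grows s S ≡ true → ∃ λ v → Arrived s v × S ≡ act s v
  grows⁻ eq = isActive⁻ (proj₁ (∧-true eq))

∈-matchedSet⁺ : ∀ {m} {M : List (Subset m × ℚ)} {T τ v} → (T , τ) ∈ M → v ∈ₛ T → v ∈ₛ matchedSet M
∈-matchedSet⁺ {T = T} (here refl) v∈ = Subₚ.p⊆p∪q _ v∈
∈-matchedSet⁺ {M = (U , _) ∷ M} (there T∈) v∈ = Subₚ.q⊆p∪q U _ (∈-matchedSet⁺ T∈ v∈)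

∈-matchedSet⁻ : ∀ {m} (M : List (Subset m × ℚ)) {v} → v ∈ₛ matchedSet M → ∃[ T ] ∃[ τ ] ((T , τ) ∈ M × v ∈ₛ T)
∈-matchedSet⁻ [] v∈ = contradiction v∈ Subₚ.∉⊥
∈-matchedSet⁻ ((T , τ) ∷ M) v∈ with Subₚ.x∈p∪q⁻ T (matchedSet M) v∈
... | inj₁ v∈T = T , τ , here refl , v∈T
... | inj₂ v∈M with ∈-matchedSet⁻ M v∈M
...   | U , υ , U∈ , v∈U = U , υ , there U∈ , v∈U

-- For u and w in different active sets no grown set contains both, so the dual
-- load of the pair is the sum of the potentials of u and w.
potential : ∀ {m} → State m → Fin m → ℚ
potential {m} s u = Σ[ allSubsets m ] λ S → if lookup S u then y s S else 0ℚ

-- The hypothesis `r-threshold` is what an arrival needs in order to respect the dual constraints: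
-- the newcomer has potential 0, an older request has at most r times its age, and that age is the
-- difference of the two arrival times.
module Dynamics {m : ℕ} (γ k : ℕ) (r : ℚ) (σ : Instance m) (r≥0 : 0ℚ ≤ℚ r)
  (r-threshold : ∀ u w → r *ℚ ∣ atime σ u -ℚ atime σ w ∣ℚ ≤ℚ threshold γ k σ u w) where

  open GD γ k r σ

  -- Every set of positive dual weight lies inside a current active set. A request that has not
  -- arrived is still its initial singleton and carries no weight, so `self` and `part` hold on all
  -- of `Fin m`.
  record Laminar (s : State m) : Set where
    field
      self    : ∀ u → u ∈ₛ act s u
      part    : ∀ {u w} → w ∈ₛ act s u → act s w ≡ act s u
      fresh   : ∀ {u} → ¬ Arrived s u → act s u ≡ ⁅ u ⁆
      y≥0     : ∀ S → 0ℚ ≤ℚ y s S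
      y-cross : ∀ {S u w} → u ∈ₛ S → w ∈ₛ S → act s u ≢ act s w → y s S ≡ 0ℚ
      y-fresh : ∀ {S u} → u ∈ₛ S → ¬ Arrived s u → y s S ≡ 0ℚ

    arrived-closed : ∀ {u w} → Arrived s u → w ∈ₛ act s u → Arrived s w
    arrived-closed {u} {w} a w∈ with toℕ w ℕ.<? nArr s
    ... | yes b = b
    ... | no ¬b = subst (Arrived s) (Subₚ.x∈⁅y⁆⇒x≡y w (subst (u ∈ₛ_) (trans (sym (part w∈)) (fresh ¬b)) (self u))) a

    load-cross : ∀ {u w} → act s u ≢ act s w → dualLoad s u w ≡ potential s u +ℚ potential s w
    load-cross {u} {w} u≢w = trans (Σ-cong (allSubsets m) term) (Σ-+ (allSubsets m) _ _)
      where
      term : ∀ S → (if inδ u w S then y s S else 0ℚ) ≡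
        (if lookup S u then y s S else 0ℚ) +ℚ (if lookup S w then y s S else 0ℚ)
      term S with lookup S u in eu | lookup S w in ew
      ... | false | false = refl
      ... | false | true  = sym (ℚₚ.+-identityˡ _)
      ... | true  | false = sym (ℚₚ.+-identityʳ _)
      ... | true  | true rewrite y-cross {S} {u} {w} (lookup⇒∈ eu) (lookup⇒∈ ew) u≢w = refl

    potential-fresh : ∀ {u} → ¬ Arrived s u → potential s u ≡ 0ℚ
    potential-fresh {u} ¬a = Σ-vanish (allSubsets m) λ S _ → term S
      where
      term : ∀ S → (if lookup S u then y s S else 0ℚ) ≡ 0ℚ
      term S with lookup S u in eu
      ... | true  = y-fresh (lookup⇒∈ eu) ¬a
      ... | false = refl

  -- A request lies in one active set at a time, so its potential grows at rate at most r from its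
  -- arrival on; while it is free, that set does grow. The two bounds together pin the potential of
  -- a free request to r times its age.
  record Inv (s : State m) : Set where
    field
      laminar     : Laminar s
      atime≤now   : ∀ {u} → Arrived s u → atime σ u ≤ℚ now s
      now≤atime   : ∀ {u} → ¬ Arrived s u → now s ≤ℚ atime σ u
      potential≤  : ∀ {u} → Arrived s u → potential s u ≤ℚ r *ℚ (now s -ℚ atime σ u)
      potential≥  : ∀ {u} → Arrived s u → u ∈ₛ freeSet s → r *ℚ (now s -ℚ atime σ u) ≤ℚ potential s u
      load≤       : ∀ {u w} → crossPair s u w → dualLoad s u w ≤ℚ threshold γ k σ u w
      group-size  : ∀ {T τ} → (T , τ) ∈ matched s → # T ≡ k
      group-atime : ∀ {T τ v} → (T , τ) ∈ matched s → v ∈ₛ T → atime σ v ≤ℚ τ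
    open Laminar laminar public

  cross-act : ∀ {s : State m} {u w} → Arrived s u → Arrived s w → act s u ≢ act s w → crossPair s u w
  cross-act {s} a b u≢w = (λ { refl → u≢w refl }) , arrived⁺ {s = s} a , arrived⁺ {s = s} b , u≢w

  inv-init : ∀ v₀ → toℕ v₀ ≡ 0 → Inv (initState v₀)
  inv-init v₀ v₀≡0 = record
    { laminar = record
      { self = Subₚ.x∈⁅x⁆
      ; part = λ {u} {w} w∈ → cong ⁅_⁆ (Subₚ.x∈⁅y⁆⇒x≡y u w∈)
      ; fresh = λ _ → refl
      ; y≥0 = λ _ → ℚₚ.≤-refl
      ; y-cross = λ _ _ _ → refl
      ; y-fresh = λ _ _ → refl }
    ; atime≤now = λ ()
    ; now≤atime = λ {u} _ → sorted σ v₀ u (subst (_≤ toℕ u) (sym v₀≡0) z≤n)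
    ; potential≤ = λ ()
    ; potential≥ = λ ()
    ; load≤ = λ { {u} (_ , a , _) → contradiction (arrived⁻ {s = initState v₀} {v = u} a) λ () }
    ; group-size = λ ()
    ; group-atime = λ () }

  module Arrive {s : State m} (I : Inv s) (v : Fin m) (v-next : toℕ v ≡ nArr s) (v-now : atime σ v ≡ now s) where
    open Inv I

    after : State m
    after = record s
      { nArr = suc (nArr s)
      ; y    = λ S → if lookup S v then 0ℚ else y s S
      ; act  = λ u → if u ==ᶠ v then ⁅ v ⁆ else act s u }

    v-fresh : ¬ Arrived s v
    v-fresh a = ℕₚ.<-irrefl v-next a

    arrived-mono : ∀ {u} → Arrived s u → Arrived after u
    arrived-mono = ℕₚ.m≤n⇒m≤1+n

    arrived-cases : ∀ {u} → Arrived after u → Arrived s u ⊎ u ≡ v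
    arrived-cases (s≤s u≤) with ℕₚ.m≤n⇒m<n∨m≡n u≤
    ... | inj₁ u< = inj₁ u<
    ... | inj₂ eq = inj₂ (Finₚ.toℕ-injective (trans eq (sym v-next)))

    act-same : ∀ u → act after u ≡ act s u
    act-same u with u Fin.≟ v
    ... | yes refl = sym (fresh v-fresh)
    ... | no _     = refl

    -- The reset of `y` at an arrival changes nothing, because by `y-fresh` sets containing an
    -- unarrived request have weight 0 already. With `act-same`, an arrival affects only who counts
    -- as arrived.
    y-same : ∀ S → y after S ≡ y s S
    y-same S with lookup S v in eq
    ... | true  = sym (y-fresh (lookup⇒∈ eq) v-fresh)
    ... | false = refl

    potential-same : ∀ u → potential after u ≡ potential s u
    potential-same u = Σ-cong (allSubsets m) λ S → cong (if lookup S u then_else 0ℚ) (y-same S)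

    laminar-after : Laminar after
    laminar-after = record
      { self = λ u → subst (u ∈ₛ_) (sym (act-same u)) (self u)
      ; part = λ {u} {w} w∈ → trans (act-same w) (trans (part (subst (w ∈ₛ_) (act-same u) w∈)) (sym (act-same u)))
      ; fresh = λ {u} ¬a → trans (act-same u) (fresh (¬a ∘ arrived-mono))
      ; y≥0 = λ S → subst (0ℚ ≤ℚ_) (sym (y-same S)) (y≥0 S)
      ; y-cross = λ {S} {u} {w} u∈ w∈ u≢w → trans (y-same S)
          (y-cross u∈ w∈ (λ eq → u≢w (trans (act-same u) (trans eq (sym (act-same w))))))
      ; y-fresh = λ {S} u∈ ¬a → trans (y-same S) (y-fresh u∈ (¬a ∘ arrived-mono)) }

    potential-new : potential s v ≡ 0ℚ
    potential-new = potential-fresh v-fresh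

    now-v : now s -ℚ atime σ v ≡ 0ℚ
    now-v = trans (cong (now s -ℚ_) v-now) (ℚₚ.+-inverseʳ (now s))

    load-new : ∀ {w} → Arrived s w → potential s w ≤ℚ r *ℚ ∣ atime σ v -ℚ atime σ w ∣ℚ
    load-new {w} a = ℚₚ.≤-trans (potential≤ a) (*-monoˡ-≤ r≥0
      (subst (λ t → now s -ℚ atime σ w ≤ℚ ∣ t -ℚ atime σ w ∣ℚ) (sym v-now) (p≤∣p∣ (now s -ℚ atime σ w))))

    load-after : ∀ {u w} → crossPair after u w → dualLoad after u w ≤ℚ threshold γ k σ u w
    load-after {u} {w} (u≢w , au , aw , u≁w) =
      subst (_≤ℚ threshold γ k σ u w) (sym split) (by-cases (arrived-cases (arrived⁻ {s = after} au)) (arrived-cases (arrived⁻ {s = after} aw)))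
      where
      act≢ : act s u ≢ act s w
      act≢ eq = u≁w (trans (act-same u) (trans eq (sym (act-same w))))
      split : dualLoad after u w ≡ potential s u +ℚ potential s w
      split = trans (Laminar.load-cross laminar-after u≁w) (cong₂ _+ℚ_ (potential-same u) (potential-same w))
      by-cases : Arrived s u ⊎ u ≡ v → Arrived s w ⊎ w ≡ v → potential s u +ℚ potential s w ≤ℚ threshold γ k σ u w
      by-cases (inj₁ a) (inj₁ b) = subst (_≤ℚ threshold γ k σ u w) (load-cross act≢) (load≤ (cross-act {s} a b act≢))
      by-cases (inj₁ a) (inj₂ refl) = subst (_≤ℚ threshold γ k σ u v)
        (trans (sym (ℚₚ.+-identityʳ _)) (cong (potential s u +ℚ_) (sym potential-new)))
        (ℚₚ.≤-trans (load-new a) (subst (λ d → r *ℚ d ≤ℚ threshold γ k σ u v) (∣p-q∣-comm (atime σ u) (atime σ v)) (r-threshold u v)))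
      by-cases (inj₂ refl) (inj₁ b) = subst (_≤ℚ threshold γ k σ v w)
        (trans (sym (ℚₚ.+-identityˡ _)) (cong (_+ℚ potential s w) (sym potential-new)))
        (ℚₚ.≤-trans (load-new b) (r-threshold v w))
      by-cases (inj₂ refl) (inj₂ refl) = contradiction refl u≢w

    inv : Inv after
    inv = record
      { laminar = laminar-after
      ; atime≤now = λ a → [ atime≤now , (λ { refl → ℚₚ.≤-reflexive v-now }) ]′ (arrived-cases a)
      ; now≤atime = λ ¬a → now≤atime (¬a ∘ arrived-mono)
      ; potential≤ = λ {u} a → subst (_≤ℚ _) (sym (potential-same u))
          ([ potential≤ , (λ { refl → ℚₚ.≤-reflexive (trans potential-new (sym (trans (cong (r *ℚ_) now-v) (ℚₚ.*-zeroʳ r)))) }) ]′ (arrived-cases a))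
      ; potential≥ = λ {u} a free → subst (_ ≤ℚ_) (sym (potential-same u))
          ([ (λ a → potential≥ a free) , (λ { refl → ℚₚ.≤-reflexive (sym (trans potential-new (sym (trans (cong (r *ℚ_) now-v) (ℚₚ.*-zeroʳ r))))) }) ]′ (arrived-cases a))
      ; load≤ = λ {u} {w} → load-after {u} {w}
      ; group-size = group-size
      ; group-atime = group-atime }

  module Merge {s : State m} (I : Inv s) (u w : Fin m) (u×w : crossPair s u w) where
    open Inv I

    A∪B : Subset m
    A∪B = act s u ∪ act s w

    after : State m
    after = record s
      { act    = λ v → if lookup A∪B v then A∪B else act s v
      ; marked = (u , w) ∷ marked s }

    in-∪ : ∀ {x z} → act s x ≡ act s z → x ∈ₛ A∪B → z ∈ₛ A∪B
    in-∪ {x} {z} eq x∈ with Subₚ.x∈p∪q⁻ (act s u) (act s w) x∈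
    ... | inj₁ x∈A = Subₚ.x∈p∪q⁺ (inj₁ (subst (z ∈ₛ_) (trans (sym eq) (part x∈A)) (self z)))
    ... | inj₂ x∈B = Subₚ.x∈p∪q⁺ (inj₂ (subst (z ∈ₛ_) (trans (sym eq) (part x∈B)) (self z)))

    -- Merging coarsens the partition. Invariants about requests in different active sets therefore
    -- survive: two requests separated afterwards were separated before.
    act-cong : ∀ {x z} → act s x ≡ act s z → act after x ≡ act after z
    act-cong {x} {z} eq with x Subₚ.∈? A∪B
    ... | yes x∈ = trans (if-∈ x∈) (sym (if-∈ (in-∪ eq x∈)))
    ... | no  x∉ = trans (if-∉ x∉) (trans eq (sym (if-∉ (x∉ ∘ in-∪ (sym eq)))))

    act-∪ : ∀ {x} → x ∈ₛ A∪B → act after x ≡ A∪B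
    act-∪ = if-∈

    act-u≡act-w : act after u ≡ act after w
    act-u≡act-w = trans (act-∪ (Subₚ.x∈p∪q⁺ (inj₁ (self u)))) (sym (act-∪ (Subₚ.x∈p∪q⁺ (inj₂ (self w)))))

    self-after : ∀ x → x ∈ₛ act after x
    self-after x with x Subₚ.∈? A∪B
    ... | yes x∈ = subst (x ∈ₛ_) (sym (if-∈ x∈)) x∈
    ... | no  x∉ = subst (x ∈ₛ_) (sym (if-∉ x∉)) (self x)

    part-after : ∀ {x z} → z ∈ₛ act after x → act after z ≡ act after x
    part-after {x} {z} z∈ with x Subₚ.∈? A∪B
    ... | yes x∈ = trans (act-∪ (subst (z ∈ₛ_) (if-∈ x∈) z∈)) (sym (if-∈ x∈))
    ... | no  x∉ = act-cong (part (subst (z ∈ₛ_) (if-∉ x∉) z∈))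

    fresh-∉ : ∀ {x} → ¬ Arrived s x → x ∉ₛ A∪B
    fresh-∉ ¬a x∈ with Subₚ.x∈p∪q⁻ (act s u) (act s w) x∈
    ... | inj₁ x∈A = ¬a (arrived-closed (arrived⁻ {s = s} (proj₁ (proj₂ u×w))) x∈A)
    ... | inj₂ x∈B = ¬a (arrived-closed (arrived⁻ {s = s} (proj₁ (proj₂ (proj₂ u×w)))) x∈B)

    inv : Inv after
    inv = record
      { laminar = record
        { self = self-after
        ; part = part-after
        ; fresh = λ ¬a → trans (if-∉ (fresh-∉ ¬a)) (fresh ¬a)
        ; y≥0 = y≥0
        ; y-cross = λ u∈ w∈ u≢w → y-cross u∈ w∈ (u≢w ∘ act-cong)
        ; y-fresh = y-fresh }
      ; atime≤now = atime≤now
      ; now≤atime = now≤atime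
      ; potential≤ = potential≤
      ; potential≥ = potential≥
      ; load≤ = λ { (x≢z , ax , az , x≁z) → load≤ (x≢z , ax , az , x≁z ∘ act-cong) }
      ; group-size = group-size
      ; group-atime = group-atime }

  module Match {s : State m} (I : Inv s) (v : Fin m) (v-arrived : arrived s v ≡ true) (T : Subset m)
    (T⊆ : ∀ x → lookup T x ≡ true → lookup (act s v ∩ freeSet s) x ≡ true) (T-size : # T ≡ k) where
    open Inv I

    after : State m
    after = record s { matched = matched s ++ ((T , now s) ∷ []) }

    T⊆act : ∀ {x} → x ∈ₛ T → x ∈ₛ act s v
    T⊆act {x} x∈ = proj₁ (Subₚ.x∈p∩q⁻ (act s v) (freeSet s) (lookup⇒∈ (T⊆ x (∈⇒lookup x∈))))

    T⊆free : ∀ {x} → x ∈ₛ T → x ∈ₛ freeSet s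
    T⊆free {x} x∈ = proj₂ (Subₚ.x∈p∩q⁻ (act s v) (freeSet s) (lookup⇒∈ (T⊆ x (∈⇒lookup x∈))))

    T-arrived : ∀ {x} → x ∈ₛ T → Arrived s x
    T-arrived x∈ = arrived-closed (arrived⁻ {s = s} v-arrived) (T⊆act x∈)

    matched-cases : ∀ {U τ} → (U , τ) ∈ matched after → (U , τ) ∈ matched s ⊎ (U ≡ T × τ ≡ now s)
    matched-cases U∈ with ∈-++⁻ (matched s) U∈
    ... | inj₁ old = inj₁ old
    ... | inj₂ (here refl) = inj₂ (refl , refl)

    free-mono : ∀ {x} → x ∈ₛ freeSet after → x ∈ₛ freeSet s
    free-mono x∈ = Subₚ.x∉p⇒x∈∁p λ x∈M → case ∈-matchedSet⁻ (matched s) x∈M of λ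
      { (U , τ , U∈ , x∈U) → Subₚ.x∈∁p⇒x∉p x∈ (∈-matchedSet⁺ (∈-++⁺ˡ U∈) x∈U) }

    inv : Inv after
    inv = record
      { laminar = record
        { self = self ; part = part ; fresh = fresh ; y≥0 = y≥0 ; y-cross = y-cross ; y-fresh = y-fresh }
      ; atime≤now = atime≤now
      ; now≤atime = now≤atime
      ; potential≤ = potential≤
      ; potential≥ = λ a free → potential≥ a (free-mono free)
      ; load≤ = load≤
      ; group-size = λ U∈ → [ group-size , (λ { (refl , _) → T-size }) ]′ (matched-cases U∈)
      ; group-atime = λ {U} {τ} {x} U∈ x∈ → [ (λ U∈ → group-atime U∈ x∈) , (λ { (refl , refl) → atime≤now (T-arrived x∈) }) ]′ (matched-cases U∈) }

  module Advance {s : State m} (I : Inv s) (Δ : ℚ) (Δ>0 : 0ℚ <ℚ Δ)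
    (no-skip : ∀ v → toℕ v ≡ nArr s → now s +ℚ Δ ≤ℚ atime σ v) where
    open Inv I

    after : State m
    after = record s
      { now = now s +ℚ Δ
      ; y   = λ S → if grows s S then y s S +ℚ r *ℚ Δ else y s S }

    rΔ≥0 : 0ℚ ≤ℚ r *ℚ Δ
    rΔ≥0 = *-nonNeg r≥0 (ℚₚ.<⇒≤ Δ>0)

    growth : Fin m → ℚ
    growth u = if grows s (act s u) then r *ℚ Δ else 0ℚ

    growth≥0 : ∀ u → 0ℚ ≤ℚ growth u
    growth≥0 u with grows s (act s u)
    ... | true  = rΔ≥0
    ... | false = ℚₚ.≤-refl

    growth≤ : ∀ u → growth u ≤ℚ r *ℚ Δ
    growth≤ u with grows s (act s u)
    ... | true  = ℚₚ.≤-refl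
    ... | false = rΔ≥0

    growth-free : ∀ {u} → Arrived s u → u ∈ₛ freeSet s → growth u ≡ r *ℚ Δ
    growth-free {u} a free = cong (if_then r *ℚ Δ else 0ℚ) (grows⁺ {s = s} a (self u) free)

    -- A set that reaches across two active sets, or contains an unarrived request, is not active;
    -- so growth cannot spoil `y-cross` or `y-fresh`.
    not-growing : ∀ {S} → (∀ v → Arrived s v → S ≢ act s v) → y after S ≡ y s S
    not-growing {S} ¬act with grows s S in eq
    ... | false = refl
    ... | true with grows⁻ {s = s} {S} eq
    ...   | v , a , S≡ = contradiction S≡ (¬act v a)

    laminar-after : Laminar after
    laminar-after = record
      { self = self ; part = part ; fresh = fresh
      ; y≥0 = y≥0-after
      ; y-cross = λ {S} u∈ w∈ u≢w → trans
          (not-growing λ { v a refl → u≢w (trans (part u∈) (sym (part w∈))) }) (y-cross u∈ w∈ u≢w)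
      ; y-fresh = λ {S} u∈ ¬a → trans (not-growing λ { v a refl → ¬a (arrived-closed a u∈) }) (y-fresh u∈ ¬a) }
      where
      y≥0-after : ∀ S → 0ℚ ≤ℚ y after S
      y≥0-after S with grows s S
      ... | true  = +-nonNeg (y≥0 S) rΔ≥0
      ... | false = y≥0 S

    -- the active sets are disjoint, so at most one of the sets containing u grows
    potential-after : ∀ {u} → Arrived s u → potential after u ≡ potential s u +ℚ growth u
    potential-after {u} a = begin
      potential after u
        ≡⟨ Σ-cong (allSubsets m) term ⟩
      Σ[ allSubsets m ] (λ S → (if lookup S u then y s S else 0ℚ) +ℚ only S)
        ≡⟨ Σ-+ (allSubsets m) _ only ⟩
      potential s u +ℚ Σ[ allSubsets m ] only
        ≡⟨ cong (potential s u +ℚ_) (Σ-single (allSubsets-unique m) (allSubsets-complete (act s u)) only-zero) ⟩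
      potential s u +ℚ only (act s u)
        ≡⟨ cong (potential s u +ℚ_) (cong (if_then growth u else 0ℚ) (==ˢ-refl (act s u))) ⟩
      potential s u +ℚ growth u ∎
      where
      open ≡-Reasoning
      only : Subset m → ℚ
      only S = if S ==ˢ act s u then growth u else 0ℚ
      only-zero : ∀ S → S ≢ act s u → only S ≡ 0ℚ
      only-zero S S≢ with S ==ˢ act s u in eq
      ... | true  = contradiction (==ˢ⇒≡ eq) S≢
      ... | false = refl
      term : ∀ S → (if lookup S u then y after S else 0ℚ) ≡ (if lookup S u then y s S else 0ℚ) +ℚ only S
      term S with S ≟ˢ act s u
      term S | yes refl rewrite ∈⇒lookup (self u) with grows s (act s u)
      ... | true  = refl
      ... | false = sym (ℚₚ.+-identityʳ _)
      term S | no S≢ with lookup S u in eu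
      ... | false = refl
      ... | true  = trans (not-growing λ { v av refl → S≢ (sym (part (lookup⇒∈ eu))) }) (sym (ℚₚ.+-identityʳ _))

    potential-mono : ∀ {u} → Arrived s u → potential s u ≤ℚ potential after u
    potential-mono {u} a = subst (potential s u ≤ℚ_) (sym (potential-after a)) (x≤x+d _ (growth≥0 u))

    now-mono : now s ≤ℚ now after
    now-mono = x≤x+d (now s) (ℚₚ.<⇒≤ Δ>0)

    r-elapsed : ∀ t → r *ℚ (now s -ℚ t) +ℚ r *ℚ Δ ≡ r *ℚ (now after -ℚ t)
    r-elapsed t = lem r (now s) t Δ
      where
      lem : ∀ r n t d → r *ℚ (n -ℚ t) +ℚ r *ℚ d ≡ r *ℚ ((n +ℚ d) -ℚ t)
      lem = solve-∀ ringℚ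

    -- An advance is limited only by the next arrival; `sorted` extends the limit to all later ones.
    now≤atime-after : ∀ {u} → ¬ Arrived s u → now after ≤ℚ atime σ u
    now≤atime-after {u} ¬a = ℚₚ.≤-trans (no-skip next next≡) (sorted σ next u (subst (_≤ toℕ u) (sym next≡) n≤u))
      where
      n≤u : nArr s ≤ toℕ u
      n≤u = ℕₚ.≮⇒≥ ¬a
      next : Fin m
      next = fromℕ< (ℕₚ.≤-<-trans n≤u (Finₚ.toℕ<n u))
      next≡ : toℕ next ≡ nArr s
      next≡ = Finₚ.toℕ-fromℕ< _

    inv : (∀ u w → crossPair after u w → dualLoad after u w ≤ℚ threshold γ k σ u w) → Inv after
    inv load≤-after = record
      { laminar = laminar-after
      ; atime≤now = λ a → ℚₚ.≤-trans (atime≤now a) now-mono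
      ; now≤atime = now≤atime-after
      ; potential≤ = λ {u} a → subst₂ _≤ℚ_ (sym (potential-after a)) (r-elapsed (atime σ u)) (ℚₚ.+-mono-≤ (potential≤ a) (growth≤ u))
      ; potential≥ = λ {u} a free → subst₂ _≤ℚ_ (r-elapsed (atime σ u))
          (sym (trans (potential-after a) (cong (potential s u +ℚ_) (growth-free a free)))) (ℚₚ.+-monoˡ-≤ (r *ℚ Δ) (potential≥ a free))
      ; load≤ = λ {u} {w} → load≤-after u w
      ; group-size = group-size
      ; group-atime = group-atime }

-- Instances arriving in rows of k requests

record RowInstance (m k : ℕ) : Set where
  field
    σ   : Instance m
    D   : ℚ
    D>0 : 0ℚ <ℚ D
    p₀ q₀   : Fin m
    toℕ-p₀  : toℕ p₀ ≡ 0
    toℕ-q₀  : toℕ q₀ ≡ 1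
    atime-p₀ : atime σ p₀ ≡ 0ℚ
    atime-q₀ : atime σ q₀ ≡ 0ℚ
    anchor   : Fin m → Fin m
    anchor-cases : ∀ v → anchor v ≡ p₀ ⊎ anchor v ≡ q₀
    early-or-late : ∀ v → v ≡ anchor v ⊎ D <ℚ atime σ v
    optCost-p₀q₀ : optCost k σ p₀ q₀ ≡ D +ℚ D
    optCost-q₀p₀ : optCost k σ q₀ p₀ ≡ D +ℚ D
    -- A request and its anchor share their position and the anchor arrives at time 0, so only the
    -- difference of arrival times is left.
    optCost-anchor : ∀ v → optCost k σ v (anchor v) ≡ atime σ v
    row      : Fin m → ℕ
    row-mono : ∀ {u v} → toℕ u ≤ toℕ v → row u ≤ row v
    row-size : ∀ v → # fibre row (row v) ≡ k
    -- 2·atime u − D is the latest time at which u is merged with its anchor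
    row-gap  : ∀ {u v} → row u <ℕ row v → atime σ u +ℚ atime σ u <ℚ atime σ v +ℚ D
    row-late : ∀ {u v} → row u <ℕ row v → D <ℚ atime σ v
    row-spread : ∀ v → ∃[ x ] ∃[ z ] (row x ≡ row v × row z ≡ row v × D ≤ℚ ∣ pos σ x -ℚ pos σ z ∣ℚ)
    -- This plays the part of the arrival time of one more row, so that the last row is forced to
    -- merge like the others.
    horizon      : ℚ
    D<horizon    : D <ℚ horizon
    horizon-late : ∀ v → atime σ v +ℚ atime σ v <ℚ horizon +ℚ D

-- The diameter function and the costs of pairs

≤foldr⊔ : ∀ {x} {xs : List ℚ} → x ∈ xs → x ≤ℚ List.foldr _⊔ℚ_ 0ℚ xs
≤foldr⊔ {xs = x ∷ xs} (here refl) = ℚₚ.p≤p⊔q x (List.foldr _⊔ℚ_ 0ℚ xs)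
≤foldr⊔ {xs = x ∷ xs} (there x∈)  = ℚₚ.≤-trans (≤foldr⊔ x∈) (ℚₚ.p≤q⊔p x (List.foldr _⊔ℚ_ 0ℚ xs))

foldr⊔≤ : ∀ {b} (xs : List ℚ) → 0ℚ ≤ℚ b → (∀ {x} → x ∈ xs → x ≤ℚ b) → List.foldr _⊔ℚ_ 0ℚ xs ≤ℚ b
foldr⊔≤ []       0≤b _  = 0≤b
foldr⊔≤ (x ∷ xs) 0≤b ub = ℚₚ.⊔-lub (ub (here refl)) (foldr⊔≤ xs 0≤b (ub ∘ there))

foldr⊔≥0 : ∀ (xs : List ℚ) → 0ℚ ≤ℚ List.foldr _⊔ℚ_ 0ℚ xs
foldr⊔≥0 []       = ℚₚ.≤-refl
foldr⊔≥0 (x ∷ xs) = ℚₚ.≤-trans (foldr⊔≥0 xs) (ℚₚ.p≤q⊔p x (List.foldr _⊔ℚ_ 0ℚ xs))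

distances : List ℚ → List ℚ
distances ps = List.concatMap (λ p → List.map (λ q → ∣ p -ℚ q ∣ℚ) ps) ps

dD≥0 : ∀ ps → 0ℚ ≤ℚ dD ps
dD≥0 ps = foldr⊔≥0 (distances ps)

dD≥ : ∀ {ps p q} → p ∈ ps → q ∈ ps → ∣ p -ℚ q ∣ℚ ≤ℚ dD ps
dD≥ {ps} {p} p∈ q∈ = ≤foldr⊔ (∈-concatMap⁺ (λ p → List.map (λ q → ∣ p -ℚ q ∣ℚ) ps) (lose p∈ (∈-map⁺ (λ q → ∣ p -ℚ q ∣ℚ) q∈)))

dD≤ : ∀ {ps b} → 0ℚ ≤ℚ b → (∀ {p q} → p ∈ ps → q ∈ ps → ∣ p -ℚ q ∣ℚ ≤ℚ b) → dD ps ≤ℚ b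
dD≤ {ps} {b} 0≤b ub = foldr⊔≤ (distances ps) 0≤b bound
  where
  bound : ∀ {x} → x ∈ distances ps → x ≤ℚ b
  bound x∈ with find (∈-concatMap⁻ (λ p → List.map (λ q → ∣ p -ℚ q ∣ℚ) ps) x∈)
  ... | p , p∈ , x∈p with ∈-map⁻ (λ q → ∣ p -ℚ q ∣ℚ) x∈p
  ...   | q , q∈ , refl = ub p∈ q∈

optCost≥∣Δatime∣ : ∀ {m} k (σ : Instance m) u w → ∣ atime σ u -ℚ atime σ w ∣ℚ ≤ℚ optCost k σ u w
optCost≥∣Δatime∣ k σ u w = subst (_≤ℚ optCost k σ u w) (ℚₚ.+-identityˡ δ)
  (ℚₚ.+-monoˡ-≤ δ {0ℚ} {dbar k (pos σ u) (pos σ w)}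
    (+-nonNeg {dH1 k (pos σ u) (pos σ w)} {dH1 k (pos σ w) (pos σ u)}
      (dD≥0 (pos σ u ∷ List.replicate (k ∸ 1) (pos σ w))) (dD≥0 (pos σ w ∷ List.replicate (k ∸ 1) (pos σ u)))))
  where δ = ∣ atime σ u -ℚ atime σ w ∣ℚ

module _ {A : Set} (slack rate : A → ℚ) (rate≥0 : ∀ x → 0ℚ ≤ℚ rate x) where

  -- Each constraint is linear in Δ. One that fails at the current Δ is made exact by shrinking Δ to
  -- slack over rate; since rates are nonnegative, the constraints met so far stay satisfied.
  first-tight : ∀ (xs : List A) → (∀ {x} → x ∈ xs → 0ℚ <ℚ slack x) → ∀ B → 0ℚ <ℚ B →
    ∃[ Δ ] (0ℚ <ℚ Δ × Δ ≤ℚ B × (∀ {x} → x ∈ xs → rate x *ℚ Δ ≤ℚ slack x)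
      × (Δ ≡ B ⊎ (∃[ x ] (x ∈ xs × rate x *ℚ Δ ≡ slack x))))
  first-tight [] _ B B>0 = B , B>0 , ℚₚ.≤-refl , (λ ()) , inj₁ refl
  first-tight (x ∷ xs) slack>0 B B>0 with first-tight xs (slack>0 ∘ there) B B>0
  ... | Δ , Δ>0 , Δ≤B , ok , reason with rate x *ℚ Δ ℚₚ.≤? slack x
  ...   | yes fits = Δ , Δ>0 , Δ≤B , (λ { (here refl) → fits ; (there z∈) → ok z∈ })
          , [ inj₁ , (λ { (z , z∈ , eq) → inj₂ (z , there z∈ , eq) }) ]′ reason
  ...   | no ¬fits = Δ′ , Δ′>0 , ℚₚ.≤-trans Δ′≤Δ Δ≤B
          , (λ { (here refl) → ℚₚ.≤-reflexive exact ; (there z∈) → ℚₚ.≤-trans (*-monoˡ-≤ (rate≥0 _) Δ′≤Δ) (ok z∈) })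
          , inj₂ (x , here refl , exact)
    where
    slack<ρΔ : slack x <ℚ rate x *ℚ Δ
    slack<ρΔ = ℚₚ.≰⇒> ¬fits
    -- With rate 0 the left side would be 0, which cannot exceed a positive slack.
    rate>0 : 0ℚ <ℚ rate x
    rate>0 = ℚₚ.≰⇒> λ rate≤0 → ℚₚ.<-asym (slack>0 (here refl))
      (subst (slack x <ℚ_) (trans (cong (_*ℚ Δ) (ℚₚ.≤-antisym rate≤0 (rate≥0 x))) (ℚₚ.*-zeroˡ Δ)) slack<ρΔ)
    instance
      rate-pos : ℚ.Positive (rate x)
      rate-pos = ℚ.positive rate>0
      rate-nonZero : ℚ.NonZero (rate x)
      rate-nonZero = ℚₚ.pos⇒nonZero (rate x)
    Δ′ : ℚ
    Δ′ = (ℚ.1/ rate x) *ℚ slack x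
    exact : rate x *ℚ Δ′ ≡ slack x
    exact = trans (sym (ℚₚ.*-assoc (rate x) (ℚ.1/ rate x) (slack x)))
      (trans (cong (_*ℚ slack x) (ℚₚ.*-inverseʳ (rate x))) (ℚₚ.*-identityˡ (slack x)))
    Δ′>0 : 0ℚ <ℚ Δ′
    Δ′>0 = *-pos (ℚₚ.positive⁻¹ (ℚ.1/ rate x) {{ℚₚ.1/pos⇒pos (rate x)}}) (slack>0 (here refl))
    Δ′≤Δ : Δ′ ≤ℚ Δ
    Δ′≤Δ = *-cancelˡ-≤ rate>0 (subst (_≤ℚ rate x *ℚ Δ) (sym exact) (ℚₚ.<⇒≤ slack<ρΔ))

-- Costs of single groups

waiting : ∀ {m} → Instance m → Subset m → ℚ → ℚ
waiting σ T τ = Σ[ elems T ] λ v → τ -ℚ atime σ v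

module _ {m} (σ : Instance m) {T : Subset m} {τ : ℚ} (after : ∀ {v} → v ∈ₛ T → atime σ v ≤ℚ τ) where

  wait≥0 : ∀ v → v ∈ elems T → 0ℚ ≤ℚ τ -ℚ atime σ v
  wait≥0 v v∈ = p-q≥0 (after (∈-elems⁻ v∈))

  waiting≥0 : 0ℚ ≤ℚ waiting σ T τ
  waiting≥0 = Σ-nonNeg (elems T) wait≥0

  groupCost≥0 : 0ℚ ≤ℚ groupCost σ (T , τ)
  groupCost≥0 = +-nonNeg (dD≥0 (List.map (pos σ) (elems T))) waiting≥0

  groupCost≥distance : ∀ {x z} → x ∈ₛ T → z ∈ₛ T → ∣ pos σ x -ℚ pos σ z ∣ℚ ≤ℚ groupCost σ (T , τ)
  groupCost≥distance x∈ z∈ = ℚₚ.≤-trans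
    (dD≥ (∈-map⁺ (pos σ) (∈-elems⁺ x∈)) (∈-map⁺ (pos σ) (∈-elems⁺ z∈)))
    (x≤x+d (dD (List.map (pos σ) (elems T))) waiting≥0)

  groupCost≥wait : ∀ {x} → x ∈ₛ T → τ -ℚ atime σ x ≤ℚ groupCost σ (T , τ)
  groupCost≥wait {x} x∈ = ℚₚ.≤-trans (Σ-term {f = λ v → τ -ℚ atime σ v} (∈-elems⁺ x∈) wait≥0)
    (subst (_≤ℚ groupCost σ (T , τ)) (ℚₚ.+-identityˡ (waiting σ T τ)) (ℚₚ.+-monoˡ-≤ (waiting σ T τ) (dD≥0 (List.map (pos σ) (elems T)))))

  -- A second member either lies elsewhere, which costs distance, or arrives later, which makes `v₀`
  -- wait. This is the source of OPT > 0.
  groupCost>0 : ∀ {v₀} → v₀ ∈ₛ T → 2 ≤ # T →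
    (∀ v → v ≢ v₀ → 0ℚ <ℚ ∣ pos σ v -ℚ pos σ v₀ ∣ℚ ⊎ atime σ v₀ <ℚ atime σ v) → 0ℚ <ℚ groupCost σ (T , τ)
  groupCost>0 {v₀} v₀∈ 2≤ alone with second-member T v₀ 2≤
  ... | v , v∈ , v≢ = [ (λ apart → ℚₚ.<-≤-trans apart (groupCost≥distance v∈ v₀∈))
                      , (λ later → ℚₚ.<-≤-trans (p-q>0 (ℚₚ.<-≤-trans later (after v∈))) (groupCost≥wait v₀∈)) ]′ (alone v v≢)

-- A union bound: a matching that covers all m requests must have at least m/k groups.
∣matchedSet∣≤ : ∀ {m} k (M : List (Subset m × ℚ)) → (∀ {T τ} → (T , τ) ∈ M → # T ≡ k) → # matchedSet M ≤ List.length M * k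
∣matchedSet∣≤ {m} k [] _ = ℕₚ.≤-reflexive (Subₚ.∣⊥∣≡0 m)
∣matchedSet∣≤ k ((T , τ) ∷ M) size = ℕₚ.≤-trans (∣p∪q∣≤∣p∣+∣q∣ T (matchedSet M))
  (ℕₚ.+-mono-≤ (ℕₚ.≤-reflexive (size (here refl))) (∣matchedSet∣≤ k M (size ∘ there)))

-- Invariants of all runs on row instances

module Rows {m k : ℕ} (k≥2 : 2 ≤ k) (ri : RowInstance m k) (r : ℚ) (r>0 : 0ℚ <ℚ r)
  (threshold≡ : ∀ u w → threshold 1 k (RowInstance.σ ri) u w ≡ r *ℚ optCost k (RowInstance.σ ri) u w) where

  open RowInstance ri
  open GD 1 k r σ

  abstract
    r≥0 : 0ℚ ≤ℚ r
    r≥0 = ℚₚ.<⇒≤ r>0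

    r-threshold : ∀ u w → r *ℚ ∣ atime σ u -ℚ atime σ w ∣ℚ ≤ℚ threshold 1 k σ u w
    r-threshold u w = subst (r *ℚ ∣ atime σ u -ℚ atime σ w ∣ℚ ≤ℚ_) (sym (threshold≡ u w))
      (*-monoˡ-≤ r≥0 (optCost≥∣Δatime∣ k σ u w))

  open Dynamics 1 k r σ r≥0 r-threshold

  p₀≢q₀ : p₀ ≢ q₀
  p₀≢q₀ eq with trans (sym toℕ-p₀) (trans (cong toℕ eq) toℕ-q₀)
  ... | ()

  -- The two phases of a run. In the first, both anchors are free and keep growing, which is
  -- possible only up to time D. The second remembers the potential r·D collected by each anchor; it
  -- persists even if their active set later stops growing.
  Separate Joined : State m → Set
  Separate s = act s p₀ ≢ act s q₀ × now s ≤ℚ D × p₀ ∈ₛ freeSet s × q₀ ∈ₛ freeSet s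
  Joined s = act s p₀ ≡ act s q₀ × r *ℚ D ≤ℚ potential s p₀ × r *ℚ D ≤ℚ potential s q₀

  -- The bound in `unmerged` is the one that drives the others: it expires for a whole row before
  -- the next row arrives. Then `last-row` confines the free requests to the newest row, which
  -- leaves the algorithm no choice but to match whole rows.
  record RowFacts (s : State m) : Set where
    field
      anchors  : Separate s ⊎ Joined s
      unmerged : ∀ {u} → Arrived s u → u ∈ₛ freeSet s → act s u ≢ act s (anchor u) → now s +ℚ D ≤ℚ atime σ u +ℚ atime σ u
      whole-rows : ∀ {T τ u w} → (T , τ) ∈ matched s → u ∈ₛ T → row w ≡ row u → w ∈ₛ T
      last-row : ∀ {u v} → Arrived s u → u ∈ₛ freeSet s → Arrived s v → row v ≤ row u

  RowInv : State m → Set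
  RowInv s = Inv s × RowFacts s

  module _ {s : State m} (R : RowInv s) where
    private inv = proj₁ R
    open Inv inv
    open RowFacts (proj₂ R)

    free-row : ∀ {u w} → u ∈ₛ freeSet s → row w ≡ row u → w ∈ₛ freeSet s
    free-row {u} {w} u-free eq = Subₚ.x∉p⇒x∈∁p λ w∈M → case ∈-matchedSet⁻ (matched s) w∈M of λ
      { (T , τ , T∈ , w∈T) → Subₚ.x∈∁p⇒x∉p u-free (∈-matchedSet⁺ T∈ (whole-rows T∈ w∈T (sym eq))) }

    joined-anchor : Joined s → ∀ v → act s (anchor v) ≡ act s p₀
    joined-anchor (p≡q , _) v with anchor-cases v
    ... | inj₁ eq = cong (act s) eq
    ... | inj₂ eq = trans (cong (act s) eq) (sym p≡q)

    -- An unarrived request is alone in its active set, whereas the two anchors share one.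
    joined-arrived : Joined s → Arrived s p₀ × Arrived s q₀
    joined-arrived (p≡q , _) = arr-p , arr-q
      where
      arr-p : Arrived s p₀
      arr-p with toℕ p₀ ℕ.<? nArr s
      ... | yes a = a
      ... | no ¬a = contradiction (sym (Subₚ.x∈⁅y⁆⇒x≡y p₀ (subst (q₀ ∈ₛ_) (trans (sym p≡q) (fresh ¬a)) (self q₀)))) p₀≢q₀
      arr-q : Arrived s q₀
      arr-q with toℕ q₀ ℕ.<? nArr s
      ... | yes a = a
      ... | no ¬a = contradiction (Subₚ.x∈⁅y⁆⇒x≡y q₀ (subst (p₀ ∈ₛ_) (trans p≡q (fresh ¬a)) (self p₀))) p₀≢q₀

    -- a fully merged row would give one active set k free requests
    overdue : settled k s → D <ℚ now s → ∀ {u} → Arrived s u → u ∈ₛ freeSet s →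
      (∀ w → row w ≡ row u → Arrived s w × atime σ w +ℚ atime σ w <ℚ now s +ℚ D) → Empty
    overdue quiet late {u} u-arr u-free due with anchors
    ... | inj₁ (_ , now≤D , _) = <⇒≱ late now≤D
    ... | inj₂ J = ℕₚ.<⇒≱ (quiet p₀ (arrived⁺ {s = s} (proj₁ (joined-arrived J)))) (begin
      k                             ≡⟨ sym (row-size u) ⟩
      # fibre row (row u)           ≤⟨ Subₚ.p⊆q⇒∣p∣≤∣q∣ row⊆ ⟩
      # (act s p₀ ∩ freeSet s)      ∎)
      where
      open ℕₚ.≤-Reasoning
      row⊆ : fibre row (row u) ⊆ act s p₀ ∩ freeSet s
      row⊆ {w} w∈ with ∈-fibre⁻ {f = row} w∈
      ... | eq with act s w ≟ˢ act s (anchor w)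
      ...   | yes same = Subₚ.x∈p∩q⁺ (subst (w ∈ₛ_) (trans same (joined-anchor J w)) (self w) , free-row u-free eq)
      ...   | no differ = contradiction (unmerged (proj₁ (due w eq)) (free-row u-free eq) differ) (<⇒≱ (proj₂ (due w eq)))

    early : now s ≤ℚ D → ∀ {u} → Arrived s u → u ≡ p₀ ⊎ u ≡ q₀
    early now≤D {u} a with early-or-late u
    ... | inj₂ late = contradiction (ℚₚ.≤-trans (atime≤now a) now≤D) (<⇒≱ late)
    ... | inj₁ eq with anchor-cases u
    ...   | inj₁ eq′ = inj₁ (trans eq eq′)
    ...   | inj₂ eq′ = inj₂ (trans eq eq′)

  rowInv-init : ∀ v₀ → toℕ v₀ ≡ 0 → RowInv (initState v₀)
  rowInv-init v₀ v₀≡0 = inv-init v₀ v₀≡0 , record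
    { anchors = inj₁ ((λ eq → p₀≢q₀ (Subₚ.x∈⁅y⁆⇒x≡y q₀ (subst (p₀ ∈ₛ_) eq (Subₚ.x∈⁅x⁆ p₀))))
        , subst (_≤ℚ D) (sym (trans (cong (atime σ) (Finₚ.toℕ-injective (trans v₀≡0 (sym toℕ-p₀)))) atime-p₀)) (ℚₚ.<⇒≤ D>0)
        , Subₚ.x∉p⇒x∈∁p Subₚ.∉⊥ , Subₚ.x∉p⇒x∈∁p Subₚ.∉⊥)
    ; unmerged = λ ()
    ; whole-rows = λ ()
    ; last-row = λ () }

  module _ {s : State m} (R : RowInv s) where
    private inv = proj₁ R
    open Inv inv
    open RowFacts (proj₂ R)

    rowInv-arrive : ∀ v (v-next : toℕ v ≡ nArr s) (v-now : atime σ v ≡ now s) → settled k s →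
      RowInv (Arrive.after inv v v-next v-now)
    rowInv-arrive v v-next v-now quiet = Ar.inv , record
      { anchors = anchors-after anchors
      ; unmerged = λ {u} a free differ → unmerged-after a free (λ eq → differ (trans (Ar.act-same u) (trans eq (sym (Ar.act-same (anchor u))))))
      ; whole-rows = whole-rows
      ; last-row = λ a free b → last-row-after (Ar.arrived-cases a) free (Ar.arrived-cases b) }
      where
      module Ar = Arrive inv v v-next v-now
      anchors-after : Separate s ⊎ Joined s → Separate Ar.after ⊎ Joined Ar.after
      anchors-after (inj₁ (p≢q , rest)) =
        inj₁ ((λ eq → p≢q (trans (sym (Ar.act-same p₀)) (trans eq (Ar.act-same q₀)))) , rest)
      anchors-after (inj₂ (p≡q , hp , hq)) = inj₂ (trans (Ar.act-same p₀) (trans p≡q (sym (Ar.act-same q₀)))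
        , subst (r *ℚ D ≤ℚ_) (sym (Ar.potential-same p₀)) hp , subst (r *ℚ D ≤ℚ_) (sym (Ar.potential-same q₀)) hq)
      unmerged-after : ∀ {u} → Arrived Ar.after u → u ∈ₛ freeSet s → act s u ≢ act s (anchor u) → now s +ℚ D ≤ℚ atime σ u +ℚ atime σ u
      unmerged-after {u} a free differ with Ar.arrived-cases a
      ... | inj₁ a′ = unmerged a′ free differ
      ... | inj₂ refl with early-or-late u
      ...   | inj₁ eq   = contradiction (cong (act s) eq) differ
      -- The newcomer has age 0, so the bound reduces to D ≤ `atime σ u`.
      ...   | inj₂ late = ℚₚ.+-mono-≤ (ℚₚ.≤-reflexive (sym v-now)) (ℚₚ.<⇒≤ late)
      last-row-after : ∀ {u w} → Arrived s u ⊎ u ≡ v → u ∈ₛ freeSet s → Arrived s w ⊎ w ≡ v → row w ≤ row u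
      last-row-after (inj₁ a) free (inj₁ b) = last-row a free b
      last-row-after (inj₂ refl) free (inj₁ b) = row-mono (ℕₚ.<⇒≤ (subst (_ <ℕ_) (sym v-next) b))
      last-row-after (inj₂ refl) free (inj₂ refl) = ℕₚ.≤-refl
      -- If `u` were free in an earlier row, that row would have arrived completely, and by
      -- `row-gap` its merging deadline would have passed at the arrival of `v`. An arrival requires
      -- a settled state, which `overdue` then contradicts.
      last-row-after {u} (inj₁ a) free (inj₂ refl) = ℕₚ.≮⇒≥ λ row< →
        overdue R quiet (subst (D <ℚ_) v-now (row-late row<)) a free λ w eq →
          subst (toℕ w <ℕ_) v-next (ℕₚ.≰⇒> λ v≤w → ℕₚ.<⇒≱ row< (subst (row v ≤_) eq (row-mono v≤w)))
          , subst (λ t → atime σ w +ℚ atime σ w <ℚ t +ℚ D) v-now (row-gap (subst (_<ℕ row v) (sym eq) row<))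

    rowInv-merge : ∀ u w (u×w : crossPair s u w) → dualLoad s u w ≡ threshold 1 k σ u w → RowInv (Merge.after inv u w u×w)
    rowInv-merge u w u×w@(u≢w , au , aw , u≁w) tight = Me.inv , record
      { anchors = inj₂ (anchors-after anchors)
      ; unmerged = λ a free differ → unmerged a free (differ ∘ Me.act-cong)
      ; whole-rows = whole-rows
      ; last-row = last-row }
      where
      module Me = Merge inv u w u×w
      -- the tight load is 2rD and each endpoint contributes at most r · now ≤ rD
      half : ∀ {x z} → Arrived s x → atime σ x ≡ 0ℚ → now s ≤ℚ D → potential s x +ℚ potential s z ≡ r *ℚ (D +ℚ D) → r *ℚ D ≤ℚ potential s z
      half {x} {z} a atime≡0 now≤D eq = ≤-shift
        (trans (lem₁ r D (r *ℚ D)) (trans (cong (_+ℚ 0ℚ) (sym eq)) (lem₂ (potential s x) (potential s z))))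
        (ℚₚ.≤-trans (potential≤ a) (*-monoˡ-≤ r≥0 (subst (λ t → now s -ℚ t ≤ℚ D) (sym atime≡0) (≤-shift (lem₃ (now s) D) now≤D))))
        where
        lem₁ : ∀ r D x → r *ℚ D +ℚ r *ℚ D ≡ r *ℚ (D +ℚ D) +ℚ 0ℚ
        lem₁ = solve-∀ ringℚ
        lem₂ : ∀ x z → (x +ℚ z) +ℚ 0ℚ ≡ z +ℚ x
        lem₂ = solve-∀ ringℚ
        lem₃ : ∀ n D → (n -ℚ 0ℚ) +ℚ D ≡ D +ℚ n
        lem₃ = solve-∀ ringℚ
      tight′ : potential s u +ℚ potential s w ≡ r *ℚ optCost k σ u w
      tight′ = trans (sym (load-cross u≁w)) (trans tight (threshold≡ u w))
      anchors-after : Separate s ⊎ Joined s → Joined Me.after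
      anchors-after (inj₂ (p≡q , hp , hq)) = Me.act-cong p≡q , hp , hq
      -- Up to time D only the anchors have arrived, so the tight pair consists of them, in one
      -- order or the other.
      anchors-after (inj₁ (_ , now≤D , _))
        with early R now≤D (arrived⁻ {s = s} au) | early R now≤D (arrived⁻ {s = s} aw)
      ... | inj₁ refl | inj₁ refl = contradiction refl u≢w
      ... | inj₂ refl | inj₂ refl = contradiction refl u≢w
      ... | inj₁ refl | inj₂ refl = Me.act-u≡act-w
        , half (arrived⁻ {s = s} aw) atime-q₀ now≤D (trans (ℚₚ.+-comm (potential s q₀) _) eq)
        , half (arrived⁻ {s = s} au) atime-p₀ now≤D eq
        where eq = trans tight′ (cong (r *ℚ_) optCost-p₀q₀)
      ... | inj₂ refl | inj₁ refl = sym Me.act-u≡act-w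
        , half (arrived⁻ {s = s} au) atime-q₀ now≤D eq
        , half (arrived⁻ {s = s} aw) atime-p₀ now≤D (trans (ℚₚ.+-comm (potential s p₀) _) eq)
        where eq = trans tight′ (cong (r *ℚ_) optCost-q₀p₀)

    rowInv-match : ∀ v (a : arrived s v ≡ true) T (T⊆ : ∀ x → lookup T x ≡ true → lookup (act s v ∩ freeSet s) x ≡ true)
      (T-size : # T ≡ k) → RowInv (Match.after inv v a T T⊆ T-size)
    rowInv-match v a T T⊆ T-size = Ma.inv , record
      { anchors = inj₂ (anchors-after anchors)
      ; unmerged = λ a free → unmerged a (Ma.free-mono free)
      ; whole-rows = λ U∈ u∈ eq → whole-rows-after (Ma.matched-cases U∈) u∈ eq
      ; last-row = λ a free → last-row a (Ma.free-mono free) }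
      where
      module Ma = Match inv v a T T⊆ T-size
      T≥2 : 2 ≤ # T
      T≥2 = subst (2 ≤_) (sym T-size) k≥2
      anchors-after : Separate s ⊎ Joined s → Joined Ma.after
      anchors-after (inj₂ J) = J
      -- A match is impossible in the first phase: the only arrived requests are the anchors, in
      -- different active sets, while a group has at least two members in one set.
      anchors-after (inj₁ (p≢q , now≤D , _)) with ∣∣>0⇒nonempty T (ℕₚ.<⇒≤ T≥2)
      ... | x , x∈ with second-member T x T≥2
      ...   | z , z∈ , z≢x with early R now≤D (Ma.T-arrived x∈) | early R now≤D (Ma.T-arrived z∈)
      ...     | inj₁ refl | inj₁ refl = contradiction refl z≢x
      ...     | inj₂ refl | inj₂ refl = contradiction refl z≢x
      ...     | inj₁ refl | inj₂ refl = contradiction (trans (part (Ma.T⊆act x∈)) (sym (part (Ma.T⊆act z∈)))) p≢q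
      ...     | inj₂ refl | inj₁ refl = contradiction (trans (part (Ma.T⊆act z∈)) (sym (part (Ma.T⊆act x∈)))) p≢q
      -- Any two members of `T` are free and arrived, so `last-row` applies in both directions. As
      -- `T` has k members and a row has k, `T` is then the whole row.
      T⊆row : ∀ {u} → u ∈ₛ T → T ⊆ fibre row (row u)
      T⊆row u∈ x∈ = ∈-fibre⁺ {f = row} (ℕₚ.≤-antisym
        (last-row (Ma.T-arrived u∈) (Ma.T⊆free u∈) (Ma.T-arrived x∈))
        (last-row (Ma.T-arrived x∈) (Ma.T⊆free x∈) (Ma.T-arrived u∈)))
      whole-rows-after : ∀ {U τ u w} → (U , τ) ∈ matched s ⊎ (U ≡ T × τ ≡ now s) → u ∈ₛ U → row w ≡ row u → w ∈ₛ U
      whole-rows-after (inj₁ U∈) u∈ eq = whole-rows U∈ u∈ eq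
      whole-rows-after {u = u} (inj₂ (refl , _)) u∈ eq =
        ⊆∧∣∣≤⇒⊇ (T⊆row u∈) (ℕₚ.≤-reflexive (trans (row-size u) (sym T-size))) (∈-fibre⁺ {f = row} eq)

    rowInv-advance : ∀ Δ (Δ>0 : 0ℚ <ℚ Δ) (no-skip : ∀ v → toℕ v ≡ nArr s → now s +ℚ Δ ≤ℚ atime σ v) →
      let s′ = Advance.after inv Δ Δ>0 no-skip in
      (∀ u w → crossPair s′ u w → dualLoad s′ u w ≤ℚ threshold 1 k σ u w) → RowInv s′
    rowInv-advance Δ Δ>0 no-skip load≤-after = I′ , record
      { anchors = anchors-after
      ; unmerged = unmerged-after
      ; whole-rows = whole-rows
      ; last-row = last-row }
      where
      module Ad = Advance inv Δ Δ>0 no-skip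
      I′ = Ad.inv load≤-after
      module I′ = Inv I′
      sum≤ : ∀ {u w} → Arrived s u → Arrived s w → act s u ≢ act s w → potential Ad.after u +ℚ potential Ad.after w ≤ℚ r *ℚ optCost k σ u w
      sum≤ {u} {w} a b u≁w = subst₂ _≤ℚ_ (I′.load-cross u≁w) (threshold≡ u w) (I′.load≤ (cross-act {Ad.after} a b u≁w))
      still-separate : Separate s → Separate Ad.after
      still-separate (p≢q , now≤D , fp , fq) = p≢q , now≤D-after , fp , fq
        where
        -- Two free anchors that arrived at time 0 have potential at least r times the clock each,
        -- while the threshold of their pair is 2rD. If one has not arrived, the clock has not
        -- passed 0.
        now≤D-after : now Ad.after ≤ℚ D
        now≤D-after with toℕ p₀ ℕ.<? nArr s | toℕ q₀ ℕ.<? nArr s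
        ... | no ¬a | _     = ℚₚ.≤-trans (I′.now≤atime ¬a) (subst (_≤ℚ D) (sym atime-p₀) (ℚₚ.<⇒≤ D>0))
        ... | yes _ | no ¬b = ℚₚ.≤-trans (I′.now≤atime ¬b) (subst (_≤ℚ D) (sym atime-q₀) (ℚₚ.<⇒≤ D>0))
        ... | yes a | yes b = ℚₚ.≮⇒≥ λ D<now → <⇒≱ (ℚₚ.+-mono-< D<now D<now) (*-cancelˡ-≤ r>0 (begin
          r *ℚ (now Ad.after +ℚ now Ad.after)
            ≡⟨ lem r (now Ad.after) ⟩
          r *ℚ (now Ad.after -ℚ 0ℚ) +ℚ r *ℚ (now Ad.after -ℚ 0ℚ)
            ≡⟨ sym (cong₂ (λ x z → r *ℚ (now Ad.after -ℚ x) +ℚ r *ℚ (now Ad.after -ℚ z)) atime-p₀ atime-q₀) ⟩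
          r *ℚ (now Ad.after -ℚ atime σ p₀) +ℚ r *ℚ (now Ad.after -ℚ atime σ q₀)
            ≤⟨ ℚₚ.+-mono-≤ (I′.potential≥ a fp) (I′.potential≥ b fq) ⟩
          potential Ad.after p₀ +ℚ potential Ad.after q₀
            ≤⟨ sum≤ a b p≢q ⟩
          r *ℚ optCost k σ p₀ q₀
            ≡⟨ cong (r *ℚ_) optCost-p₀q₀ ⟩
          r *ℚ (D +ℚ D) ∎))
          where
          open ℚₚ.≤-Reasoning
          lem : ∀ r n → r *ℚ (n +ℚ n) ≡ r *ℚ (n -ℚ 0ℚ) +ℚ r *ℚ (n -ℚ 0ℚ)
          lem = solve-∀ ringℚ
      still-joined : Joined s → Joined Ad.after
      still-joined J@(p≡q , hp , hq) = p≡q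
        , ℚₚ.≤-trans hp (Ad.potential-mono (proj₁ (joined-arrived R J)))
        , ℚₚ.≤-trans hq (Ad.potential-mono (proj₂ (joined-arrived R J)))
      anchors-after : Separate Ad.after ⊎ Joined Ad.after
      anchors-after = [ inj₁ ∘ still-separate , inj₂ ∘ still-joined ]′ anchors
      anchor-high : Joined s → ∀ u → Arrived s (anchor u) × r *ℚ D ≤ℚ potential Ad.after (anchor u)
      anchor-high J u = [ (λ eq → subst High (sym eq) (proj₁ (joined-arrived R J) , proj₁ (proj₂ (still-joined J))))
                        , (λ eq → subst High (sym eq) (proj₂ (joined-arrived R J) , proj₂ (proj₂ (still-joined J)))) ]′ (anchor-cases u)
        where
        High : Fin m → Set
        High x = Arrived s x × r *ℚ D ≤ℚ potential Ad.after x
      unmerged-after : ∀ {u} → Arrived s u → u ∈ₛ freeSet s → act s u ≢ act s (anchor u) → now Ad.after +ℚ D ≤ℚ atime σ u +ℚ atime σ u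
      unmerged-after {u} a free differ with anchors
      -- While the anchors are separate, the clock is at most D, so even the stronger bound D + D
      -- holds against twice a late arrival time.
      ... | inj₁ S with early-or-late u
      ...   | inj₁ eq   = contradiction (cong (act s) eq) differ
      ...   | inj₂ late = ℚₚ.+-mono-≤ (ℚₚ.≤-trans (proj₁ (proj₂ (still-separate S))) (ℚₚ.<⇒≤ late)) (ℚₚ.<⇒≤ late)
      unmerged-after {u} a free differ | inj₂ J = ≤-shift (lem₂ (now Ad.after) D (atime σ u)) (*-cancelˡ-≤ r>0 (begin
          r *ℚ ((now Ad.after -ℚ atime σ u) +ℚ D)
            ≡⟨ lem r (now Ad.after) (atime σ u) D ⟩
          r *ℚ (now Ad.after -ℚ atime σ u) +ℚ r *ℚ D
            ≤⟨ ℚₚ.+-mono-≤ (I′.potential≥ a free) (proj₂ (anchor-high J u)) ⟩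
          potential Ad.after u +ℚ potential Ad.after (anchor u)
            ≤⟨ sum≤ a (proj₁ (anchor-high J u)) differ ⟩
          r *ℚ optCost k σ u (anchor u)
            ≡⟨ cong (r *ℚ_) (optCost-anchor u) ⟩
          r *ℚ atime σ u ∎))
        where
        open ℚₚ.≤-Reasoning
        lem : ∀ r n t D → r *ℚ ((n -ℚ t) +ℚ D) ≡ r *ℚ (n -ℚ t) +ℚ r *ℚ D
        lem = solve-∀ ringℚ
        lem₂ : ∀ n D t → (n +ℚ D) +ℚ t ≡ (t +ℚ t) +ℚ ((n -ℚ t) +ℚ D)
        lem₂ = solve-∀ ringℚ

  rowInv-step : ∀ {s s′} → RowInv s → Step s s′ → RowInv s′
  rowInv-step R (arrive v v-next v-now quiet) = rowInv-arrive R v v-next v-now quiet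
  rowInv-step R (merge u w u×w tight _)       = rowInv-merge R u w u×w tight
  rowInv-step R (match v a T T⊆ T-size)       = rowInv-match R v a T T⊆ T-size
  rowInv-step R (advance Δ Δ>0 _ no-skip _ load≤) = rowInv-advance R Δ Δ>0 no-skip load≤

  rowInv-star : ∀ {s s′} → RowInv s → Star Step s s′ → RowInv s′
  rowInv-star R ε        = R
  rowInv-star R (x ◅ xs) = rowInv-star (rowInv-step R x) xs

  -- Existence of a complete run

  Tight : State m → Set
  Tight s = ∃[ u ] ∃[ w ] (crossPair s u w × dualLoad s u w ≡ threshold 1 k σ u w)

  crossPair? : ∀ (s : State m) u w → Dec (crossPair s u w)
  crossPair? s u w = ¬? (u Fin.≟ w) ×-dec (arrived s u Boolₚ.≟ true) ×-dec (arrived s w Boolₚ.≟ true) ×-dec ¬? (act s u ≟ˢ act s w)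

  tight? : ∀ s → Dec (Tight s)
  tight? s = Finₚ.any? λ u → Finₚ.any? λ w → crossPair? s u w ×-dec (dualLoad s u w ℚₚ.≟ threshold 1 k σ u w)

  pairs : List (Fin m × Fin m)
  pairs = List.cartesianProduct (allFin m) (allFin m)

  crossing? : ∀ (s : State m) (e : Fin m × Fin m) → Dec (act s (proj₁ e) ≢ act s (proj₂ e))
  crossing? s (u , w) = ¬? (act s u ≟ˢ act s w)

  crossings : State m → ℕ
  crossings s = List.length (List.filter (crossing? s) pairs)

  -- Arrivals lower the first summand, merges the second and matches the third, and none of them
  -- raises another summand.
  measure : State m → ℕ
  measure s = ((m ∸ nArr s) +ℕ crossings s) +ℕ # freeSet s

  module _ {s : State m} (R : RowInv s) where
    open Inv (proj₁ R)

    private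
      speed : Fin m → ℚ
      speed u = if grows s (act s u) then r else 0ℚ

      speed≥0 : ∀ u → 0ℚ ≤ℚ speed u
      speed≥0 u with grows s (act s u)
      ... | true  = r≥0
      ... | false = ℚₚ.≤-refl

      slack rate : Fin m × Fin m → ℚ
      slack (u , w) = threshold 1 k σ u w -ℚ dualLoad s u w
      rate (u , w) = speed u +ℚ speed w

      rate≥0 : ∀ e → 0ℚ ≤ℚ rate e
      rate≥0 (u , w) = +-nonNeg (speed≥0 u) (speed≥0 w)

      cross? : ∀ (e : Fin m × Fin m) → Dec (crossPair s (proj₁ e) (proj₂ e))
      cross? (u , w) = crossPair? s u w

      cross : List (Fin m × Fin m)
      cross = List.filter cross? pairs

      cross⁺ : ∀ {u w} → crossPair s u w → (u , w) ∈ cross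
      cross⁺ {u} {w} u×w = ∈-filter⁺ cross? (∈-cartesianProduct⁺ (∈-allFin u) (∈-allFin w)) u×w

      cross⁻ : ∀ {u w} → (u , w) ∈ cross → crossPair s u w
      cross⁻ e∈ = proj₂ (∈-filter⁻ cross? {xs = pairs} e∈)

    -- During an advance the set of growing sets is fixed, so the load of a crossing pair is linear
    -- in time, with slope the sum of the speeds at its two endpoints. The longest admissible Δ up
    -- to `B` therefore either is `B` or makes some pair tight.
    advance-until : settled k s → ¬ Tight s → ∀ B → 0ℚ <ℚ B →
      (∀ v → toℕ v ≡ nArr s → now s +ℚ B ≤ℚ atime σ v) →
      ∃[ Δ ] ∃[ Δ>0 ] ∃[ no-skip ] (let s′ = Advance.after (proj₁ R) Δ Δ>0 no-skip in
        Step s s′ × (Δ ≡ B ⊎ Tight s′))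
    advance-until quiet loose B B>0 no-skip-B =
      Δ , Δ>0 , no-skip , advance Δ Δ>0 quiet no-skip (λ u w u×w eq → loose (u , w , u×w , eq)) load≤-after
        , [ inj₁ , (λ { ((u , w) , e∈ , eq) → inj₂ (u , w , cross⁻ e∈ , trans (load-after (cross⁻ e∈)) (exact eq)) }) ]′ reason
      where
      slack>0 : ∀ {e} → e ∈ cross → 0ℚ <ℚ slack e
      -- The invariant gives slack at least 0, and the absence of tight pairs excludes 0.
      slack>0 {u , w} e∈ = p-q>0 (ℚₚ.≰⇒> λ thr≤ → loose (u , w , cross⁻ e∈ , ℚₚ.≤-antisym (load≤ (cross⁻ e∈)) thr≤))
      found = first-tight slack rate rate≥0 cross slack>0 B B>0
      Δ : ℚ
      Δ = proj₁ found
      Δ>0 : 0ℚ <ℚ Δ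
      Δ>0 = proj₁ (proj₂ found)
      Δ≤B : Δ ≤ℚ B
      Δ≤B = proj₁ (proj₂ (proj₂ found))
      fits : ∀ {e} → e ∈ cross → rate e *ℚ Δ ≤ℚ slack e
      fits = proj₁ (proj₂ (proj₂ (proj₂ found)))
      reason : Δ ≡ B ⊎ (∃[ e ] (e ∈ cross × rate e *ℚ Δ ≡ slack e))
      reason = proj₂ (proj₂ (proj₂ (proj₂ found)))
      no-skip : ∀ v → toℕ v ≡ nArr s → now s +ℚ Δ ≤ℚ atime σ v
      no-skip v v-next = ℚₚ.≤-trans (ℚₚ.+-monoʳ-≤ (now s) Δ≤B) (no-skip-B v v-next)
      module Ad = Advance (proj₁ R) Δ Δ>0 no-skip
      growth≡ : ∀ u → Ad.growth u ≡ speed u *ℚ Δ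
      growth≡ u with grows s (act s u)
      ... | true  = refl
      ... | false = sym (ℚₚ.*-zeroˡ Δ)
      load-after : ∀ {u w} → crossPair s u w → dualLoad Ad.after u w ≡ dualLoad s u w +ℚ rate (u , w) *ℚ Δ
      load-after {u} {w} (_ , au , aw , u≁w) = begin
        dualLoad Ad.after u w
          ≡⟨ Laminar.load-cross Ad.laminar-after u≁w ⟩
        potential Ad.after u +ℚ potential Ad.after w
          ≡⟨ cong₂ _+ℚ_ (Ad.potential-after (arrived⁻ {s = s} au)) (Ad.potential-after (arrived⁻ {s = s} aw)) ⟩
        (potential s u +ℚ Ad.growth u) +ℚ (potential s w +ℚ Ad.growth w)
          ≡⟨ cong₂ (λ a b → (potential s u +ℚ a) +ℚ (potential s w +ℚ b)) (growth≡ u) (growth≡ w) ⟩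
        (potential s u +ℚ speed u *ℚ Δ) +ℚ (potential s w +ℚ speed w *ℚ Δ)
          ≡⟨ lem (potential s u) (potential s w) (speed u) (speed w) Δ ⟩
        (potential s u +ℚ potential s w) +ℚ rate (u , w) *ℚ Δ
          ≡⟨ cong (_+ℚ rate (u , w) *ℚ Δ) (sym (load-cross u≁w)) ⟩
        dualLoad s u w +ℚ rate (u , w) *ℚ Δ ∎
        where
        open ≡-Reasoning
        lem : ∀ p q a b Δ → (p +ℚ a *ℚ Δ) +ℚ (q +ℚ b *ℚ Δ) ≡ (p +ℚ q) +ℚ (a +ℚ b) *ℚ Δ
        lem = solve-∀ ringℚ
      load+slack : ∀ l t → l +ℚ (t -ℚ l) ≡ t
      load+slack = solve-∀ ringℚ
      exact : ∀ {u w} → rate (u , w) *ℚ Δ ≡ slack (u , w) → dualLoad s u w +ℚ rate (u , w) *ℚ Δ ≡ threshold 1 k σ u w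
      exact {u} {w} eq = trans (cong (dualLoad s u w +ℚ_) eq) (load+slack (dualLoad s u w) (threshold 1 k σ u w))
      load≤-after : ∀ u w → crossPair Ad.after u w → dualLoad Ad.after u w ≤ℚ threshold 1 k σ u w
      load≤-after u w u×w = subst₂ _≤ℚ_ (sym (load-after u×w)) (load+slack (dualLoad s u w) (threshold 1 k σ u w))
        (ℚₚ.+-monoʳ-≤ (dualLoad s u w) (fits (cross⁺ u×w)))

    measure-arrive : ∀ v (v-next : toℕ v ≡ nArr s) (v-now : atime σ v ≡ now s) →
      measure (Arrive.after (proj₁ R) v v-next v-now) <ℕ measure s
    measure-arrive v v-next v-now = ℕₚ.+-monoˡ-< (# freeSet s) (ℕₚ.+-mono-<-≤
      (ℕₚ.∸-monoʳ-< (ℕₚ.n<1+n (nArr s)) (subst (_<ℕ m) v-next (Finₚ.toℕ<n v)))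
      (count-mono (crossing? Ar.after) (crossing? s) (λ e differ eq → differ (trans (Ar.act-same (proj₁ e)) (trans eq (sym (Ar.act-same (proj₂ e)))))) pairs))
      where module Ar = Arrive (proj₁ R) v v-next v-now

    measure-merge : ∀ u w (u×w : crossPair s u w) → measure (Merge.after (proj₁ R) u w u×w) <ℕ measure s
    measure-merge u w u×w@(_ , _ , _ , u≁w) = ℕₚ.+-monoˡ-< (# freeSet s) (ℕₚ.+-monoʳ-< (m ∸ nArr s)
      (count-mono-< (crossing? Me.after) (crossing? s) (λ e differ → differ ∘ Me.act-cong)
        (∈-cartesianProduct⁺ (∈-allFin u) (∈-allFin w)) (λ differ → differ Me.act-u≡act-w) u≁w))
      where module Me = Merge (proj₁ R) u w u×w

    measure-match : ∀ v (a : arrived s v ≡ true) T (T⊆ : ∀ x → lookup T x ≡ true → lookup (act s v ∩ freeSet s) x ≡ true)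
      (T-size : # T ≡ k) → measure (Match.after (proj₁ R) v a T T⊆ T-size) <ℕ measure s
    measure-match v a T T⊆ T-size = ℕₚ.+-monoʳ-< ((m ∸ nArr s) +ℕ crossings s) (Subₚ.p⊂q⇒∣p∣<∣q∣ shrinks)
      where
      module Ma = Match (proj₁ R) v a T T⊆ T-size
      shrinks : freeSet Ma.after Subset.⊂ freeSet s
      shrinks with ∣∣>0⇒nonempty T (ℕₚ.≤-trans (s≤s z≤n) (subst (2 ≤_) (sym T-size) k≥2))
      ... | x , x∈T = Ma.free-mono , x , Ma.T⊆free x∈T
        , λ x∈ → Subₚ.x∈∁p⇒x∉p x∈ (∈-matchedSet⁺ (∈-++⁺ʳ (matched s) (here refl)) x∈T)

  Completes : State m → Set
  Completes s = ∃[ s′ ] (Star Step s s′ × Complete s′)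

  continue : ∀ {s s′} → Step s s′ → Completes s′ → Completes s
  continue step (s″ , steps , done) = s″ , step ◅ steps , done

  -- advancing the clock leaves the measure unchanged, but can be chosen to enable a discrete step
  completes : ∀ n {s} → measure s <ℕ n → nArr s ≤ m → RowInv s → Completes s
  completes (suc n) {s} (s≤s μ≤n) n≤m R with Finₚ.any? (λ v → (arrived s v Boolₚ.≟ true) ×-dec (k ℕ.≤? # (act s v ∩ freeSet s)))
  ... | yes (v , a , k≤) = match-some (subset-of-size (act s v ∩ freeSet s) k k≤)
    where
    match-some : ∃[ T ] (T ⊆ act s v ∩ freeSet s × # T ≡ k) → Completes s
    match-some (T , T⊆ , T-size) = continue (match v a T T⊆′ T-size)
      (completes n (ℕₚ.<-≤-trans (measure-match R v a T T⊆′ T-size) μ≤n) n≤m (rowInv-match R v a T T⊆′ T-size))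
      where
      T⊆′ : ∀ x → lookup T x ≡ true → lookup (act s v ∩ freeSet s) x ≡ true
      T⊆′ x eq = ∈⇒lookup (T⊆ (lookup⇒∈ eq))
  ... | no unmatched = rest
    where
    quiet : settled k s
    quiet v a = ℕₚ.≰⇒> λ k≤ → unmatched (v , a , k≤)

    merge-at : ∀ {s′} (R′ : RowInv s′) → measure s′ ≤ n → nArr s′ ≤ m → settled k s′ → Tight s′ → Completes s′
    merge-at R′ μ≤ n≤m quiet′ (u , w , u×w , tight) = continue (merge u w u×w tight quiet′)
      (completes n (ℕₚ.<-≤-trans (measure-merge R′ u w u×w) μ≤) n≤m (rowInv-merge R′ u w u×w tight))

    arrive-at : ∀ {s′} (R′ : RowInv s′) → measure s′ ≤ n → settled k s′ → ∀ v → toℕ v ≡ nArr s′ → atime σ v ≡ now s′ → Completes s′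
    arrive-at R′ μ≤ quiet′ v v-next v-now = continue (arrive v v-next v-now quiet′)
      (completes n (ℕₚ.<-≤-trans (measure-arrive R′ v v-next v-now) μ≤)
        (subst (_<ℕ m) v-next (Finₚ.toℕ<n v)) (rowInv-arrive R′ v v-next v-now quiet′))

    Advances : ℚ → Set
    Advances B = ∃[ Δ ] ∃[ Δ>0 ] ∃[ no-skip ] (let s′ = Advance.after (proj₁ R) Δ Δ>0 no-skip in
      Step s s′ × (Δ ≡ B ⊎ Tight s′))

    after-advance : ∀ {B} → (∀ {s′} → RowInv s′ → nArr s′ ≡ nArr s → freeSet s′ ≡ freeSet s → settled k s′ → measure s′ ≡ measure s →
      now s′ ≡ now s +ℚ B → Completes s′) → Advances B → Completes s
    after-advance at-B (Δ , Δ>0 , no-skip , step , inj₂ tight) =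
      continue step (merge-at (rowInv-step R step) μ≤n n≤m quiet tight)
    after-advance at-B (Δ , Δ>0 , no-skip , step , inj₁ Δ≡B) =
      continue step (at-B (rowInv-step R step) refl refl quiet refl (cong (now s +ℚ_) Δ≡B))

    wait-for-arrival : ¬ Tight s → ∀ v → toℕ v ≡ nArr s → now s <ℚ atime σ v → Completes s
    wait-for-arrival loose v v-next now< = after-advance
      (λ R′ nArr≡ _ quiet′ μ≡ now≡ → arrive-at R′ (subst (_≤ n) (sym μ≡) μ≤n) quiet′ v (trans v-next (sym nArr≡))
        (sym (trans now≡ (lem (now s) (atime σ v)))))
      (advance-until R quiet loose (atime σ v -ℚ now s) (p-q>0 now<)
        (λ v′ v′-next → subst (λ x → now s +ℚ (atime σ v -ℚ now s) ≤ℚ atime σ x)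
          (Finₚ.toℕ-injective (trans v-next (sym v′-next))) (ℚₚ.≤-reflexive (lem (now s) (atime σ v)))))
      where
      lem : ∀ a b → a +ℚ (b -ℚ a) ≡ b
      lem = solve-∀ ringℚ

    -- With all requests arrived and one still free, a wait beyond the horizon would make its row
    -- overdue in a settled state. So the advance must have stopped earlier, at a tight pair.
    wait-for-merge : ¬ Tight s → m ≤ nArr s → ∀ {u} → u ∈ₛ freeSet s → Completes s
    wait-for-merge loose m≤n {u} u-free = after-advance
      (λ {s′} R′ nArr≡ free≡ quiet′ _ now≡ → let late = subst (horizon <ℚ_) (sym now≡) horizon<now+B in
        ⊥-elim (overdue R′ quiet′ (ℚₚ.<-trans D<horizon late) (all-arrived nArr≡ u) (subst (u ∈ₛ_) (sym free≡) u-free)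
          λ w _ → all-arrived nArr≡ w , ℚₚ.<-trans (horizon-late w) (ℚₚ.+-monoˡ-< D late)))
      (advance-until R quiet loose B B>0 (λ v v-next → contradiction (subst (_<ℕ m) v-next (Finₚ.toℕ<n v)) (ℕₚ.≤⇒≯ m≤n)))
      where
      all-arrived : ∀ {a} → a ≡ nArr s → ∀ (v : Fin m) → toℕ v <ℕ a
      all-arrived eq v = ℕₚ.<-≤-trans (Finₚ.toℕ<n v) (subst (m ≤_) (sym eq) m≤n)
      -- The absolute value keeps `B` positive on either side of the horizon, and the added 1 makes
      -- the new time strictly later than it.
      δ B : ℚ
      δ = ∣ horizon -ℚ now s ∣ℚ
      B = 1ℚ +ℚ δ
      B>0 : 0ℚ <ℚ B
      B>0 = ℚₚ.<-≤-trans (ℚₚ.positive⁻¹ 1ℚ) (x≤x+d 1ℚ (ℚₚ.0≤∣p∣ (horizon -ℚ now s)))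
      horizon<now+B : horizon <ℚ now s +ℚ B
      horizon<now+B = ℚₚ.≤-<-trans (≤-shift (lem₁ horizon (now s) δ) (p≤∣p∣ (horizon -ℚ now s)))
        (subst (now s +ℚ δ <ℚ_) (lem₂ (now s) δ) (x<x+d (now s +ℚ δ) (ℚₚ.positive⁻¹ 1ℚ)))
        where
        lem₁ : ∀ h n a → h +ℚ a ≡ (n +ℚ a) +ℚ (h -ℚ n)
        lem₁ = solve-∀ ringℚ
        lem₂ : ∀ n a → (n +ℚ a) +ℚ 1ℚ ≡ n +ℚ (1ℚ +ℚ a)
        lem₂ = solve-∀ ringℚ

    rest : Completes s
    rest with tight? s
    ... | yes tight = merge-at R μ≤n n≤m quiet tight
    ... | no loose with nArr s ℕ.<? m
    ...   | yes n<m with atime σ (fromℕ< n<m) ℚₚ.≟ now s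
    ...     | yes v-now = arrive-at R μ≤n quiet (fromℕ< n<m) (Finₚ.toℕ-fromℕ< n<m) v-now
    ...     | no  v-later = wait-for-arrival loose (fromℕ< n<m) v-next (ℚₚ.≰⇒> λ atime≤ → v-later
                (ℚₚ.≤-antisym atime≤ (Inv.now≤atime (proj₁ R) (λ a → ℕₚ.<-irrefl v-next a))))
      where v-next = Finₚ.toℕ-fromℕ< n<m
    rest | no loose | no n≮m with Subₚ.nonempty? (freeSet s)
    ...   | yes (u , u-free) = wait-for-merge loose (ℕₚ.≮⇒≥ n≮m) u-free
    ...   | no  none = s , ε , ℕₚ.≤-antisym n≤m (ℕₚ.≮⇒≥ n≮m) , λ v → ∉⇒lookup λ v-free → none (v , v-free)

  final-state-exists : ∃[ s ] FinalState s
  final-state-exists with completes (suc (measure (initState p₀))) ℕₚ.≤-refl z≤n (rowInv-init p₀ toℕ-p₀)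
  ... | s , steps , done = s , p₀ , toℕ-p₀ , steps , done

  algCost≥ : ∀ n → m ≡ n * k → ∀ s → FinalState s → ℕtoℚ n *ℚ D ≤ℚ algCost s
  algCost≥ n m≡ s (v₀ , v₀≡0 , steps , n≡m , all-matched) = begin
    ℕtoℚ n *ℚ D                        ≤⟨ ℚₚ.*-monoʳ-≤-nonNeg D {{ℚ.nonNegative (ℚₚ.<⇒≤ D>0)}} (ℕtoℚ-mono-≤ n≤) ⟩
    ℕtoℚ (List.length (matched s)) *ℚ D ≡⟨ sym (Σ-const (matched s) D) ⟩
    Σ[ matched s ] (λ _ → D)           ≤⟨ Σ-mono (matched s) (λ { (T , τ) T∈ → expensive T∈ }) ⟩
    algCost s                          ∎
    where
    open ℚₚ.≤-Reasoning
    R : RowInv s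
    R = rowInv-star (rowInv-init v₀ v₀≡0) steps
    open Inv (proj₁ R)
    open RowFacts (proj₂ R)
    all∈ : Subset.⊤ ⊆ matchedSet (matched s)
    all∈ {v} _ = Subₚ.x∉∁p⇒x∈p (lookup⇒∉ (all-matched v))
    n≤ : n ≤ List.length (matched s)
    n≤ = ℕₚ.*-cancelʳ-≤ n (List.length (matched s)) k {{ℕ.>-nonZero (ℕₚ.≤-trans (s≤s z≤n) k≥2)}}
      (ℕₚ.≤-trans (ℕₚ.≤-reflexive (trans (sym m≡) (sym (Subₚ.∣⊤∣≡n m))))
        (ℕₚ.≤-trans (Subₚ.p⊆q⇒∣p∣≤∣q∣ all∈) (∣matchedSet∣≤ k (matched s) group-size)))
    expensive : ∀ {T τ} → (T , τ) ∈ matched s → D ≤ℚ groupCost σ (T , τ)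
    expensive {T} T∈ with ∣∣>0⇒nonempty T (ℕₚ.≤-trans (s≤s z≤n) (subst (2 ≤_) (sym (group-size T∈)) k≥2))
    ... | v , v∈ with row-spread v
    ...   | x , z , x~v , z~v , far = ℚₚ.≤-trans far
            (groupCost≥distance σ (group-atime T∈) (whole-rows T∈ v∈ x~v) (whole-rows T∈ v∈ z~v))

-- Offline solutions

count : ∀ {m} → Fin m → List (Subset m) → ℕ
count v Ts = List.length (List.filter (λ T → lookup T v Boolₚ.≟ true) Ts)

count-map : ∀ {A : Set} {m} (f : A → Subset m) v xs →
  List.length (List.filter (λ x → lookup (f x) v Boolₚ.≟ true) xs) ≡ count v (List.map f xs)
count-map f v [] = refl
count-map f v (x ∷ xs) with lookup (f x) v
... | true  = cong suc (count-map f v xs)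
... | false = count-map f v xs

count-∷ : ∀ {m} (v : Fin m) T Ts → count v Ts ≤ count v (T ∷ Ts)
count-∷ v T Ts with lookup T v
... | true  = ℕₚ.n≤1+n _
... | false = ℕₚ.≤-refl

count-∈ : ∀ {m} {v : Fin m} {T} → v ∈ₛ T → ∀ Ts → count v (T ∷ Ts) ≡ suc (count v Ts)
count-∈ {v = v} v∈ Ts rewrite ∈⇒lookup v∈ = refl

count-⋃ : ∀ {m} {v : Fin m} Ts → v ∈ₛ Subset.⋃ Ts → 1 ≤ count v Ts
count-⋃ [] v∈ = contradiction v∈ Subₚ.∉⊥
count-⋃ {v = v} (T ∷ Ts) v∈ with Subₚ.x∈p∪q⁻ T (Subset.⋃ Ts) v∈
... | inj₁ v∈T = subst (1 ≤_) (sym (count-∈ v∈T Ts)) (s≤s z≤n)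
... | inj₂ v∈Ts = ℕₚ.≤-trans (count-⋃ Ts v∈Ts) (count-∷ v T Ts)

-- Each group contributes an element not covered by the groups behind it. The resulting bound by m
-- on the number of groups makes the list of candidate solutions finite.
disjoint-length : ∀ {m} (Ts : List (Subset m)) → (∀ {T} → T ∈ Ts → 1 ≤ # T) → (∀ v → count v Ts ≤ 1) →
  List.length Ts ≤ # Subset.⋃ Ts
disjoint-length [] _ _ = z≤n
disjoint-length (T ∷ Ts) nonempty once with ∣∣>0⇒nonempty T (nonempty (here refl))
... | x , x∈T = ℕₚ.≤-<-trans
  (disjoint-length Ts (nonempty ∘ there) (λ v → ℕₚ.≤-trans (count-∷ v T Ts) (once v)))
  (Subₚ.p⊂q⇒∣p∣<∣q∣ (Subₚ.q⊆p∪q T (Subset.⋃ Ts) , x , Subₚ.x∈p∪q⁺ (inj₁ x∈T)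
    , λ x∈ → ℕₚ.<⇒≱ (s≤s (count-⋃ Ts x∈)) (subst (_≤ 1) (count-∈ x∈T Ts) (once x))))

lists≤ : ∀ {A : Set} → List A → ℕ → List (List A)
lists≤ xs zero    = [] ∷ []
lists≤ xs (suc n) = [] ∷ List.cartesianProductWith _∷_ xs (lists≤ xs n)

lists≤-complete : ∀ {A : Set} (xs : List A) n zs → (∀ {z} → z ∈ zs → z ∈ xs) → List.length zs ≤ n → zs ∈ lists≤ xs n
lists≤-complete xs zero    []       _  _         = here refl
lists≤-complete xs (suc n) []       _  _         = here refl
lists≤-complete xs (suc n) (z ∷ zs) in-xs (s≤s len) =
  there (∈-cartesianProductWith⁺ _∷_ (in-xs (here refl)) (lists≤-complete xs n zs (in-xs ∘ there) len))

minimum-over : ∀ {A : Set} {P : A → Set} (P? : ∀ x → Dec (P x)) (f : A → ℚ) x₀ → P x₀ → ∀ xs →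
  ∃[ x ] (P x × (∀ {z} → z ∈ xs → P z → f x ≤ℚ f z))
minimum-over P? f x₀ p₀ [] = x₀ , p₀ , λ ()
minimum-over P? f x₀ p₀ (z ∷ zs) with minimum-over P? f x₀ p₀ zs
... | x , px , least with P? z | f z ℚₚ.≤? f x
...   | yes pz | yes z≤x = z , pz , λ { (here refl) _ → ℚₚ.≤-refl ; (there u∈) pu → ℚₚ.≤-trans z≤x (least u∈ pu) }
...   | yes pz | no  z≰x = x , px , λ { (here refl) _ → ℚₚ.<⇒≤ (ℚₚ.≰⇒> z≰x) ; (there u∈) pu → least u∈ pu }
...   | no ¬pz | _       = x , px , λ { (here refl) pz → contradiction pz ¬pz ; (there u∈) pu → least u∈ pu }

module Optimum {m k : ℕ} (k≥1 : 1 ≤ k) (σ : Instance m) (atime≥0 : ∀ v → 0ℚ ≤ℚ atime σ v) where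

  open OfflineSolution

  cost : OfflineSolution k σ → ℚ
  cost sol = matchingCost σ (groups sol)

  -- The default 0 of the fold is harmless: arrival times are nonnegative and the groups are
  -- nonempty.
  latest : Subset m → ℚ
  latest T = List.foldr _⊔ℚ_ 0ℚ (List.map (atime σ) (elems T))

  atLatest : List (Subset m) → List (Subset m × ℚ)
  atLatest = List.map λ T → T , latest T

  Valid : List (Subset m) → Set
  Valid Ts = All (λ T → # T ≡ k) Ts × (∀ v → count v Ts ≡ 1)

  valid? : ∀ Ts → Dec (Valid Ts)
  valid? Ts = All.all? (λ T → # T ℕₚ.≟ k) Ts ×-dec Finₚ.all? (λ v → count v Ts ℕₚ.≟ 1)

  atLatest-proj₁ : ∀ Ts → List.map proj₁ (atLatest Ts) ≡ Ts
  atLatest-proj₁ []       = refl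
  atLatest-proj₁ (T ∷ Ts) = cong (T ∷_) (atLatest-proj₁ Ts)

  fromValid : ∀ {Ts} → Valid Ts → OfflineSolution k σ
  fromValid {Ts} (sizes , once) = record
    { groups = atLatest Ts
    ; sizeK = λ T∈ → size (∈-map⁻ _ T∈)
    ; afterArr = λ T∈ v v∈ → after (∈-map⁻ _ T∈) (lookup⇒∈ v∈)
    ; partition = λ v → trans (count-map proj₁ v (atLatest Ts)) (trans (cong (count v) (atLatest-proj₁ Ts)) (once v)) }
    where
    size : ∀ {T τ} → ∃[ U ] (U ∈ Ts × (T , τ) ≡ (U , latest U)) → # T ≡ k
    size (U , U∈ , refl) = All.lookup sizes U∈
    after : ∀ {T τ v} → ∃[ U ] (U ∈ Ts × (T , τ) ≡ (U , latest U)) → v ∈ₛ T → atime σ v ≤ℚ τ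
    after (U , U∈ , refl) v∈ = ≤foldr⊔ (∈-map⁺ (atime σ) (∈-elems⁺ v∈))

  subsets : OfflineSolution k σ → List (Subset m)
  subsets sol = List.map proj₁ (groups sol)

  subsets-valid : ∀ sol → Valid (subsets sol)
  subsets-valid sol = All.tabulate (λ T∈ → size (∈-map⁻ proj₁ T∈)) , λ v → trans (sym (count-map proj₁ v (groups sol))) (partition sol v)
    where
    size : ∀ {T} → ∃[ g ] (g ∈ groups sol × T ≡ proj₁ g) → # T ≡ k
    size (_ , g∈ , refl) = sizeK sol g∈

  cost-atLatest : ∀ sol → matchingCost σ (atLatest (subsets sol)) ≤ℚ cost sol
  cost-atLatest sol = go (groups sol) (sizeK sol) (λ T∈ v∈ → afterArr sol T∈ _ (∈⇒lookup v∈))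
    where
    go : ∀ gs → (∀ {T τ} → (T , τ) ∈ gs → # T ≡ k) → (∀ {T τ v} → (T , τ) ∈ gs → v ∈ₛ T → atime σ v ≤ℚ τ) →
      matchingCost σ (atLatest (List.map proj₁ gs)) ≤ℚ matchingCost σ gs
    go [] _ _ = ℚₚ.≤-refl
    go ((T , τ) ∷ gs) size after = ℚₚ.+-mono-≤
      (ℚₚ.+-monoʳ-≤ (dD (List.map (pos σ) (elems T))) (Σ-mono (elems T) (λ v _ → ℚₚ.+-monoˡ-≤ (ℚ.- atime σ v) latest≤τ)))
      (go gs (size ∘ there) (after ∘ there))
      where
      latest≤τ : latest T ≤ℚ τ
      -- A member of `T` witnesses that the default 0 of the fold is at most τ as well.
      latest≤τ with ∣∣>0⇒nonempty T (subst (1 ≤_) (sym (size (here refl))) k≥1)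
      ... | v , v∈ = foldr⊔≤ (List.map (atime σ) (elems T)) (ℚₚ.≤-trans (atime≥0 v) (after (here refl) v∈)) bound
        where
        bound : ∀ {x} → x ∈ List.map (atime σ) (elems T) → x ≤ℚ τ
        bound x∈ with ∈-map⁻ (atime σ) x∈
        ... | w , w∈ , refl = after (here refl) (∈-elems⁻ w∈)

  candidates : List (List (Subset m))
  candidates = lists≤ (allSubsets m) m

  subsets∈candidates : ∀ sol → subsets sol ∈ candidates
  subsets∈candidates sol = lists≤-complete (allSubsets m) m (subsets sol) (λ {T} _ → allSubsets-complete T)
    (ℕₚ.≤-trans (disjoint-length (subsets sol)
      (λ T∈ → subst (1 ≤_) (sym (All.lookup (proj₁ (subsets-valid sol)) T∈)) k≥1)
      (λ v → ℕₚ.≤-reflexive (proj₂ (subsets-valid sol) v)))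
      (Subₚ.∣p∣≤n (Subset.⋃ (subsets sol))))

  -- matching every group when its last member arrives is optimal, so finitely many solutions compete
  opt-exists : OfflineSolution k σ → ∃[ opt ] IsOPT k σ opt
  opt-exists sol₀ with minimum-over valid? (matchingCost σ ∘ atLatest) (subsets sol₀) (subsets-valid sol₀) candidates
  ... | Ts , valid , least = matchingCost σ (atLatest Ts) , (fromValid valid , refl) , λ sol →
    ℚₚ.≤-trans (least (subsets∈candidates sol) (subsets-valid sol)) (cost-atLatest sol)

  opt>0 : 2 ≤ k → ∀ v₀ → (∀ v → v ≢ v₀ → 0ℚ <ℚ ∣ pos σ v -ℚ pos σ v₀ ∣ℚ ⊎ atime σ v₀ <ℚ atime σ v) →
    ∀ {opt} → IsOPT k σ opt → 0ℚ <ℚ opt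
  opt>0 k≥2 v₀ alone ((sol , refl) , _) = positive (group-of (ℕₚ.≤-reflexive (sym (partition sol v₀))))
    where
    after : ∀ {T τ v} → (T , τ) ∈ groups sol → v ∈ₛ T → atime σ v ≤ℚ τ
    after T∈ v∈ = afterArr sol T∈ _ (∈⇒lookup v∈)
    group-of : ∀ {gs} → 1 ≤ List.length (List.filter (λ g → lookup (proj₁ g) v₀ Boolₚ.≟ true) gs) →
      ∃[ g ] (g ∈ gs × v₀ ∈ₛ proj₁ g)
    group-of {g ∷ gs} 1≤ with lookup (proj₁ g) v₀ in eq
    ... | true  = g , here refl , lookup⇒∈ eq
    ... | false with group-of {gs} 1≤
    ...   | h , h∈ , v₀∈ = h , there h∈ , v₀∈
    positive : ∃[ g ] (g ∈ groups sol × v₀ ∈ₛ proj₁ g) → 0ℚ <ℚ cost sol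
    positive ((T , τ) , T∈ , v₀∈) = ℚₚ.<-≤-trans
      (groupCost>0 σ (after T∈) v₀∈ (subst (2 ≤_) (sym (sizeK sol T∈)) k≥2) alone)
      (Σ-term {f = groupCost σ} T∈ (λ { (U , υ) U∈ → groupCost≥0 σ (after U∈) }))

-- Double counting: after exchanging the sums, each request contributes its value once per group
-- that contains it, hence exactly once.
Σ-partition : ∀ {m} (Ts : List (Subset m)) → (∀ v → count v Ts ≡ 1) → ∀ f →
  Σ[ Ts ] (λ T → Σ[ elems T ] f) ≡ Σ[ allFin m ] f
Σ-partition {m} Ts once f = begin
  Σ[ Ts ] (λ T → Σ[ elems T ] f)
    ≡⟨ Σ-cong Ts (λ T → Σ-filter (lookup T) f (allFin m)) ⟩
  Σ[ Ts ] (λ T → Σ[ allFin m ] (λ v → if lookup T v then f v else 0ℚ))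
    ≡⟨ Σ-swap Ts (allFin m) _ ⟩
  Σ[ allFin m ] (λ v → Σ[ Ts ] (λ T → if lookup T v then f v else 0ℚ))
    ≡⟨ Σ-cong (allFin m) (λ v → sym (Σ-filter (λ T → lookup T v) (λ _ → f v) Ts)) ⟩
  Σ[ allFin m ] (λ v → Σ[ List.filter (λ T → lookup T v Boolₚ.≟ true) Ts ] (λ _ → f v))
    ≡⟨ Σ-cong (allFin m) (λ v → Σ-const (List.filter (λ T → lookup T v Boolₚ.≟ true) Ts) (f v)) ⟩
  Σ[ allFin m ] (λ v → ℕtoℚ (count v Ts) *ℚ f v)
    ≡⟨ Σ-cong (allFin m) (λ v → trans (cong (λ n → ℕtoℚ n *ℚ f v) (once v)) (ℚₚ.*-identityˡ (f v))) ⟩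
  Σ[ allFin m ] f ∎
  where open ≡-Reasoning

-- The lower-bound instance

count-unique : ∀ {A : Set} {P : A → Set} (P? : ∀ x → Dec (P x)) {x xs} → Unique xs → x ∈ xs → P x → (∀ {z} → P z → z ≡ x) →
  List.length (List.filter P? xs) ≡ 1
count-unique {A} {P} P? {x} un x∈ px only = go un x∈
  where
  none : ∀ {xs} → All (x ≢_) xs → List.length (List.filter P? xs) ≡ 0
  none [] = refl
  none {z ∷ _} (x≢z ∷ rest) with P? z
  ... | yes pz = contradiction (sym (only pz)) x≢z
  ... | no _   = none rest
  go : ∀ {xs} → Unique xs → x ∈ xs → List.length (List.filter P? xs) ≡ 1
  go {z ∷ _} (x∉ ∷ _) (here refl) with P? x
  ... | yes _  = cong suc (none x∉)
  ... | no ¬px = contradiction px ¬px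
  go {z ∷ _} (z∉ ∷ un) (there x∈) with P? z
  ... | yes pz = contradiction (only pz) (All.lookup z∉ x∈)
  ... | no _   = go un x∈

dH1≡ : ∀ {k} → 2 ≤ k → ∀ p q → dH1 k p q ≡ ∣ p -ℚ q ∣ℚ
dH1≡ {suc zero} (s≤s ())
dH1≡ {suc (suc k)} _ p q = ℚₚ.≤-antisym (dD≤ (ℚₚ.0≤∣p∣ (p -ℚ q)) bound) (dD≥ {ps} (here refl) (there (here refl)))
  where
  ps = p ∷ List.replicate (suc k) q
  member : ∀ {x} → x ∈ ps → x ≡ p ⊎ x ≡ q
  member (here eq)  = inj₁ eq
  member (there x∈) = inj₂ (All.lookup (replicate⁺ (suc k) refl) x∈)
    where
    replicate⁺ : ∀ n {x : ℚ} → x ≡ q → All (_≡ q) (List.replicate n x)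
    replicate⁺ zero    eq = []
    replicate⁺ (suc n) eq = eq ∷ replicate⁺ n eq
  zero-distance : ∀ x → ∣ x -ℚ x ∣ℚ ≤ℚ ∣ p -ℚ q ∣ℚ
  zero-distance x = subst (_≤ℚ ∣ p -ℚ q ∣ℚ) (sym (∣p-p∣≡0 x)) (ℚₚ.0≤∣p∣ (p -ℚ q))
  bound : ∀ {x z} → x ∈ ps → z ∈ ps → ∣ x -ℚ z ∣ℚ ≤ℚ ∣ p -ℚ q ∣ℚ
  bound x∈ z∈ with member x∈ | member z∈
  ... | inj₁ refl | inj₁ refl = zero-distance p
  ... | inj₁ refl | inj₂ refl = ℚₚ.≤-refl
  ... | inj₂ refl | inj₁ refl = ℚₚ.≤-reflexive (∣p-q∣-comm q p)
  ... | inj₂ refl | inj₂ refl = zero-distance q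

-- The reason for powers of 3: `row-gap` asks for twice an earlier offset to lie strictly below the
-- next one, and powers of 2 would only give equality.
2*3^a<3^b : ∀ {a b} → a <ℕ b → 3 ^ a +ℕ 3 ^ a <ℕ 3 ^ b
2*3^a<3^b {a} {b} a<b = ℕₚ.<-≤-trans
  (subst (3 ^ a +ℕ 3 ^ a <ℕ_) (ℕₚ.+-assoc (3 ^ a) (3 ^ a) (3 ^ a +ℕ 0))
    (ℕₚ.m<m+n (3 ^ a +ℕ 3 ^ a) (ℕₚ.m≤n⇒m≤n+o 0 (ℕₚ.m^n>0 3 a))))
  (ℕₚ.^-monoʳ-≤ 3 a<b)

module Grid (k : ℕ) (k≥2 : 2 ≤ k) where

  instance
    k-nonZero : NonZero k
    k-nonZero = ℕ.>-nonZero (ℕₚ.≤-trans (s≤s z≤n) k≥2)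

  quotient : ∀ a {c} → c <ℕ k → (a * k +ℕ c) / k ≡ a
  quotient a {c} c<k = begin
    (a * k +ℕ c) / k        ≡⟨ DivMod.+-distrib-/-∣ˡ c (Div.n∣m*n a) ⟩
    a * k / k +ℕ c / k      ≡⟨ cong₂ _+ℕ_ (DivMod.m*n/n≡m a k) (DivMod.m<n⇒m/n≡0 c<k) ⟩
    a +ℕ 0                  ≡⟨ ℕₚ.+-identityʳ a ⟩
    a                       ∎
    where open ≡-Reasoning

  remainder : ∀ a {c} → c <ℕ k → (a * k +ℕ c) % k ≡ c
  remainder a {c} c<k = trans (cong (_% k) (ℕₚ.+-comm (a * k) c)) (trans (DivMod.[m+kn]%n≡m%n c a k) (DivMod.m<n⇒m%n≡m c<k))

  recompose : ∀ x → (x / k) * k +ℕ x % k ≡ x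
  recompose x = trans (ℕₚ.+-comm ((x / k) * k) (x % k)) (sym (DivMod.m≡m%n+[m/n]*n x k))

  bounded : ∀ {a c n} → a <ℕ n → c <ℕ k → a * k +ℕ c <ℕ n * k
  bounded {a} {c} {n} a<n c<k = ℕₚ.<-≤-trans (ℕₚ.+-monoʳ-< (a * k) c<k)
    (subst (_≤ n * k) (ℕₚ.+-comm k (a * k)) (ℕₚ.*-monoˡ-≤ k a<n))

module Concrete (j k : ℕ) (k≥2 : 2 ≤ k) (j≥1 : 1 ≤ j) where

  open Grid k k≥2

  m n : ℕ
  m = j * (k * k)
  n = j * k

  m≡n*k : m ≡ n * k
  m≡n*k = sym (ℕₚ.*-assoc j k k)

  n≥1 : 1 ≤ n
  n≥1 = ℕₚ.*-mono-≤ j≥1 (ℕₚ.<⇒≤ k≥2)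

  row col : Fin m → ℕ
  row v = toℕ v / k
  col v = toℕ v % k

  row<n : ∀ v → row v <ℕ n
  row<n v = DivMod.m<n*o⇒m/o<n (subst (toℕ v <ℕ_) m≡n*k (Finₚ.toℕ<n v))

  col<k : ∀ v → col v <ℕ k
  col<k v = DivMod.m%n<n (toℕ v) k

  module _ {a c} (a<n : a <ℕ n) (c<k : c <ℕ k) where

    elem : Fin m
    elem = fromℕ< (subst (a * k +ℕ c <ℕ_) (sym m≡n*k) (bounded a<n c<k))

    toℕ-elem : toℕ elem ≡ a * k +ℕ c
    toℕ-elem = Finₚ.toℕ-fromℕ< _

    row-elem : row elem ≡ a
    row-elem = trans (cong (_/ k) toℕ-elem) (quotient a c<k)

    col-elem : col elem ≡ c
    col-elem = trans (cong (_% k) toℕ-elem) (remainder a c<k)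

  elem-unique : ∀ {a c} (a<n : a <ℕ n) (c<k : c <ℕ k) {v} → row v ≡ a → col v ≡ c → elem a<n c<k ≡ v
  elem-unique a<n c<k {v} refl refl = Finₚ.toℕ-injective (trans (toℕ-elem a<n c<k) (recompose (toℕ v)))

  1<k : 1 <ℕ k
  1<k = k≥2

  0<k : 0 <ℕ k
  0<k = ℕₚ.<⇒≤ 1<k

  p₀ q₀ : Fin m
  p₀ = elem n≥1 0<k
  q₀ = elem n≥1 1<k

  -- a waiting time of at most E per request costs at most D in total
  E Dℕ : ℕ
  E  = 3 ^ n
  Dℕ = m * E

  posAt : ℕ → ℕ
  posAt zero    = 0
  posAt (suc _) = Dℕ

  -- The first argument is the index of the request, the second its row. Indices 0 and 1 are `p₀`
  -- and `q₀`, which lie in row 0 because k ≥ 2.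
  atimeAt : ℕ → ℕ → ℕ
  atimeAt zero          _ = 0
  atimeAt (suc zero)    _ = 0
  atimeAt (suc (suc _)) b = Dℕ +ℕ 3 ^ b

  atimeℕ : Fin m → ℕ
  atimeℕ v = atimeAt (toℕ v) (row v)

  atimeAt-mono : ∀ {x z a b} → x ≤ z → a ≤ b → atimeAt x a ≤ atimeAt z b
  atimeAt-mono {zero}        _ _ = z≤n
  atimeAt-mono {suc zero}    _ _ = z≤n
  atimeAt-mono {suc (suc _)} {suc (suc _)} _ a≤b = ℕₚ.+-monoʳ-≤ Dℕ (ℕₚ.^-monoʳ-≤ 3 a≤b)
  atimeAt-mono {suc (suc _)} {suc zero} (s≤s ()) _

  row-mono : ∀ {u v : Fin m} → toℕ u ≤ toℕ v → row u ≤ row v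
  row-mono = DivMod./-monoˡ-≤ k

  abstract
    D : ℚ
    D = ℕtoℚ Dℕ

    D≡ : D ≡ ℕtoℚ Dℕ
    D≡ = refl

    positions : ℕ → ℚ
    positions c = ℕtoℚ (posAt c)

    positions-0 : positions 0 ≡ 0ℚ
    positions-0 = refl

    positions-suc : ∀ c → positions (suc c) ≡ D
    positions-suc c = refl

    times : Fin m → ℚ
    times v = ℕtoℚ (atimeℕ v)

    times≡ : ∀ v → times v ≡ ℕtoℚ (atimeℕ v)
    times≡ v = refl

    times-sorted : ∀ (u v : Fin m) → toℕ u ≤ toℕ v → times u ≤ℚ times v
    times-sorted u v u≤v = ℕtoℚ-mono-≤ (atimeAt-mono u≤v (row-mono u≤v))

  σ : Instance m
  σ = record { pos = positions ∘ col ; atime = times ; sorted = times-sorted }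

  toℕ-p₀ : toℕ p₀ ≡ 0
  toℕ-p₀ = toℕ-elem n≥1 0<k

  toℕ-q₀ : toℕ q₀ ≡ 1
  toℕ-q₀ = toℕ-elem n≥1 1<k

  times-at : ∀ {x} v → toℕ v ≡ x → times v ≡ ℕtoℚ (atimeAt x (row v))
  times-at v eq = trans (times≡ v) (cong (λ x → ℕtoℚ (atimeAt x (row v))) eq)

  times-p₀ : times p₀ ≡ 0ℚ
  times-p₀ = times-at p₀ toℕ-p₀

  times-q₀ : times q₀ ≡ 0ℚ
  times-q₀ = times-at q₀ toℕ-q₀

  times-late : ∀ v {x} → toℕ v ≡ suc (suc x) → times v ≡ D +ℚ ℕtoℚ (3 ^ row v)
  times-late v eq = trans (times-at v eq) (trans (ℕtoℚ-+ Dℕ (3 ^ row v)) (cong (_+ℚ ℕtoℚ (3 ^ row v)) (sym D≡)))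

  3^>0 : ∀ b → 0ℚ <ℚ ℕtoℚ (3 ^ b)
  3^>0 b = 0<ℕtoℚ {3 ^ b} (ℕₚ.m^n>0 3 b)

  D>0 : 0ℚ <ℚ D
  D>0 = subst (0ℚ <ℚ_) (sym D≡) (0<ℕtoℚ {Dℕ} (ℕₚ.*-mono-≤ {1} {m} {1} (ℕₚ.*-mono-≤ j≥1 (ℕₚ.*-mono-≤ 0<k 0<k)) (ℕₚ.m^n>0 3 n)))

  anchorAt : ℕ → Fin m
  anchorAt zero    = p₀
  anchorAt (suc _) = q₀

  anchorAt-cases : ∀ c → anchorAt c ≡ p₀ ⊎ anchorAt c ≡ q₀
  anchorAt-cases zero    = inj₁ refl
  anchorAt-cases (suc _) = inj₂ refl

  pos-anchor : ∀ c → positions (col (anchorAt c)) ≡ positions c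
  pos-anchor zero    = cong positions (col-elem n≥1 0<k)
  pos-anchor (suc c) = trans (cong positions (col-elem n≥1 1<k)) (trans (positions-suc 0) (sym (positions-suc c)))

  times-anchor : ∀ c → times (anchorAt c) ≡ 0ℚ
  times-anchor zero    = times-p₀
  times-anchor (suc _) = times-q₀

  data Age (v : Fin m) : Set where
    early : v ≡ anchorAt (col v) → times v ≡ 0ℚ → Age v
    late  : times v ≡ D +ℚ ℕtoℚ (3 ^ row v) → Age v

  age : ∀ v → Age v
  age v = go (toℕ v) refl
    where
    go : ∀ x → toℕ v ≡ x → Age v
    go zero eq = early (trans v≡ (cong anchorAt (sym (trans (cong col v≡) (col-elem n≥1 0<k))))) (trans (cong times v≡) times-p₀)
      where
      v≡ : v ≡ p₀
      v≡ = Finₚ.toℕ-injective (trans eq (sym toℕ-p₀))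
    go (suc zero) eq = early (trans v≡ (cong anchorAt (sym (trans (cong col v≡) (col-elem n≥1 1<k))))) (trans (cong times v≡) times-q₀)
      where
      v≡ : v ≡ q₀
      v≡ = Finₚ.toℕ-injective (trans eq (sym toℕ-q₀))
    go (suc (suc x)) eq = late (times-late v eq)

  late>D : ∀ {v} → times v ≡ D +ℚ ℕtoℚ (3 ^ row v) → D <ℚ times v
  late>D {v} eq = subst (D <ℚ_) (sym eq) (x<x+d D (3^>0 (row v)))

  times≥0 : ∀ v → 0ℚ ≤ℚ times v
  times≥0 v = subst (0ℚ ≤ℚ_) (sym (times≡ v)) (0≤ℕtoℚ (atimeℕ v))

  early-or-late : ∀ v → v ≡ anchorAt (col v) ⊎ D <ℚ times v
  early-or-late v with age v
  ... | early eq _ = inj₁ eq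
  ... | late eq    = inj₂ (late>D eq)

  optCost≡ : ∀ u w → optCost k σ u w ≡
    (∣ pos σ u -ℚ pos σ w ∣ℚ +ℚ ∣ pos σ w -ℚ pos σ u ∣ℚ) +ℚ ∣ times u -ℚ times w ∣ℚ
  optCost≡ u w = cong (_+ℚ ∣ times u -ℚ times w ∣ℚ) (cong₂ _+ℚ_ (dH1≡ k≥2 (pos σ u) (pos σ w)) (dH1≡ k≥2 (pos σ w) (pos σ u)))

  pos-p₀ : pos σ p₀ ≡ 0ℚ
  pos-p₀ = trans (cong positions (col-elem n≥1 0<k)) positions-0

  pos-q₀ : pos σ q₀ ≡ D
  pos-q₀ = trans (cong positions (col-elem n≥1 1<k)) (positions-suc 0)

  ∣D-0∣ : ∣ D -ℚ 0ℚ ∣ℚ ≡ D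
  ∣D-0∣ = trans (cong ∣_∣ℚ (p-0≡p D)) (ℚₚ.0≤p⇒∣p∣≡p (ℚₚ.<⇒≤ D>0))

  ∣0-D∣ : ∣ 0ℚ -ℚ D ∣ℚ ≡ D
  ∣0-D∣ = trans (∣p-q∣-comm 0ℚ D) ∣D-0∣

  optCost-p₀q₀ : optCost k σ p₀ q₀ ≡ D +ℚ D
  optCost-p₀q₀ = trans (optCost≡ p₀ q₀) (trans (cong₂ _+ℚ_
    (cong₂ _+ℚ_ (trans (cong₂ (λ x z → ∣ x -ℚ z ∣ℚ) pos-p₀ pos-q₀) ∣0-D∣) (trans (cong₂ (λ x z → ∣ x -ℚ z ∣ℚ) pos-q₀ pos-p₀) ∣D-0∣))
    (cong₂ (λ x z → ∣ x -ℚ z ∣ℚ) times-p₀ times-q₀)) (ℚₚ.+-identityʳ (D +ℚ D)))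

  optCost-q₀p₀ : optCost k σ q₀ p₀ ≡ D +ℚ D
  optCost-q₀p₀ = trans (optCost≡ q₀ p₀) (trans (cong₂ _+ℚ_
    (cong₂ _+ℚ_ (trans (cong₂ (λ x z → ∣ x -ℚ z ∣ℚ) pos-q₀ pos-p₀) ∣D-0∣) (trans (cong₂ (λ x z → ∣ x -ℚ z ∣ℚ) pos-p₀ pos-q₀) ∣0-D∣))
    (cong₂ (λ x z → ∣ x -ℚ z ∣ℚ) times-q₀ times-p₀)) (ℚₚ.+-identityʳ (D +ℚ D)))

  optCost-anchor : ∀ v → optCost k σ v (anchorAt (col v)) ≡ atime σ v
  optCost-anchor v = trans (optCost≡ v a) (trans (cong₂ _+ℚ_
      (cong₂ _+ℚ_ (trans (cong (λ x → ∣ pos σ v -ℚ x ∣ℚ) (pos-anchor (col v))) (∣p-p∣≡0 (pos σ v)))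
                  (trans (cong (λ x → ∣ x -ℚ pos σ v ∣ℚ) (pos-anchor (col v))) (∣p-p∣≡0 (pos σ v))))
      (trans (cong (λ t → ∣ times v -ℚ t ∣ℚ) (times-anchor (col v)))
        (trans (cong ∣_∣ℚ (p-0≡p (times v))) (ℚₚ.0≤p⇒∣p∣≡p (times≥0 v)))))
    (ℚₚ.+-identityˡ (times v)))
    where a = anchorAt (col v)

  row-size : ∀ v → # fibre row (row v) ≡ k
  row-size v = ℕₚ.≤-antisym
    (covered⇒∣∣≤ k f λ {x} x∈ → Fin.fromℕ< (col<k x)
      , elem-unique (row<n v) (Finₚ.toℕ<n (fromℕ< (col<k x))) (∈-fibre⁻ {f = row} x∈) (sym (Finₚ.toℕ-fromℕ< (col<k x))))
    (injective⇒≤∣∣ k f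
      (λ {x} {z} eq → Finₚ.toℕ-injective (trans (sym (col-elem (row<n v) (Finₚ.toℕ<n x))) (trans (cong col eq) (col-elem (row<n v) (Finₚ.toℕ<n z)))))
      (λ x → ∈-fibre⁺ {f = row} (row-elem (row<n v) (Finₚ.toℕ<n x))))
    where
    f : Fin k → Fin m
    f c = elem (row<n v) (Finₚ.toℕ<n c)

  double-gap : ∀ {a b} → a <ℕ b →
    (D +ℚ ℕtoℚ (3 ^ a)) +ℚ (D +ℚ ℕtoℚ (3 ^ a)) <ℚ (D +ℚ ℕtoℚ (3 ^ b)) +ℚ D
  double-gap {a} {b} a<b = <-shift (lem D (ℕtoℚ (3 ^ a)) (ℕtoℚ (3 ^ b)))
    (subst (_<ℚ ℕtoℚ (3 ^ b)) (ℕtoℚ-+ (3 ^ a) (3 ^ a)) (ℕtoℚ-mono-< (2*3^a<3^b a<b)))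
    where
    lem : ∀ D x z → ((D +ℚ x) +ℚ (D +ℚ x)) +ℚ z ≡ ((D +ℚ z) +ℚ D) +ℚ (x +ℚ x)
    lem = solve-∀ ringℚ

  -- With `b` the row of a later request this is `row-gap`; with `b` = `n`, one past the last row,
  -- it is `horizon-late`.
  double-bound : ∀ u {b} → row u <ℕ b → times u +ℚ times u <ℚ (D +ℚ ℕtoℚ (3 ^ b)) +ℚ D
  double-bound u {b} row< with age u
  ... | late eq = subst (λ t → t +ℚ t <ℚ (D +ℚ ℕtoℚ (3 ^ b)) +ℚ D) (sym eq) (double-gap row<)
  ... | early _ eq = subst (λ t → t +ℚ t <ℚ (D +ℚ ℕtoℚ (3 ^ b)) +ℚ D) (sym eq)
    (ℚₚ.<-≤-trans (ℚₚ.<-trans D>0 (x<x+d D (3^>0 b))) (x≤x+d (D +ℚ ℕtoℚ (3 ^ b)) (ℚₚ.<⇒≤ D>0)))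

  -- A request in a positive row has index at least k ≥ 2, so it is neither of the two early ones.
  later-row : ∀ {a v} → a <ℕ row v → times v ≡ D +ℚ ℕtoℚ (3 ^ row v)
  later-row {a} {v} a< = go (toℕ v) refl
    where
    first-row : ∀ {x} → x <ℕ k → toℕ v ≢ x
    first-row x<k eq = contradiction (subst (a <ℕ_) (trans (cong (_/ k) eq) (DivMod.m<n⇒m/n≡0 x<k)) a<) λ ()
    go : ∀ x → toℕ v ≡ x → times v ≡ D +ℚ ℕtoℚ (3 ^ row v)
    go zero          eq = contradiction eq (first-row 0<k)
    go (suc zero)    eq = contradiction eq (first-row 1<k)
    go (suc (suc x)) eq = times-late v eq

  row-spread : ∀ v → ∃[ x ] ∃[ z ] (row x ≡ row v × row z ≡ row v × D ≤ℚ ∣ pos σ x -ℚ pos σ z ∣ℚ)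
  row-spread v = elem (row<n v) 0<k , elem (row<n v) 1<k , row-elem (row<n v) 0<k , row-elem (row<n v) 1<k
    , ℚₚ.≤-reflexive (sym (trans (cong₂ (λ x z → ∣ x -ℚ z ∣ℚ)
        (trans (cong positions (col-elem (row<n v) 0<k)) positions-0)
        (trans (cong positions (col-elem (row<n v) 1<k)) (positions-suc 0))) ∣0-D∣))

  rowInstance : RowInstance m k
  rowInstance = record
    { σ = σ ; D = D ; D>0 = D>0
    ; p₀ = p₀ ; q₀ = q₀ ; toℕ-p₀ = toℕ-p₀ ; toℕ-q₀ = toℕ-q₀ ; atime-p₀ = times-p₀ ; atime-q₀ = times-q₀
    ; anchor = anchorAt ∘ col
    ; anchor-cases = anchorAt-cases ∘ col
    ; early-or-late = early-or-late
    ; optCost-p₀q₀ = optCost-p₀q₀ ; optCost-q₀p₀ = optCost-q₀p₀ ; optCost-anchor = optCost-anchor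
    ; row = row ; row-mono = row-mono ; row-size = row-size
    ; row-gap = λ {u} {v} row< → subst (λ t → times u +ℚ times u <ℚ t +ℚ D) (sym (later-row row<)) (double-bound u row<)
    ; row-late = λ {u} {v} row< → late>D (later-row row<)
    ; row-spread = row-spread
    ; horizon = D +ℚ ℕtoℚ (3 ^ n)
    ; D<horizon = x<x+d D (3^>0 n)
    ; horizon-late = λ v → double-bound v (row<n v) }

  r : ℚ
  r = recipℕ (k * k)

  r>0 : 0ℚ <ℚ r
  r>0 = recipℕ-pos (ℕₚ.*-mono-≤ 0<k 0<k)

  threshold≡ : ∀ u w → threshold 1 k σ u w ≡ r *ℚ optCost k σ u w
  threshold≡ u w = cong (λ x → recipℕ (x * k) *ℚ optCost k σ u w) (ℕₚ.*-identityˡ k)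

  -- the offline solution matches requests with equal column in k consecutive rows
  batch : Fin m → ℕ
  batch v = (row v / k) * k +ℕ col v

  batch<n : ∀ v → batch v <ℕ n
  batch<n v = bounded {n = j} (DivMod.m<n*o⇒m/o<n {n = j} (row<n v)) (col<k v)

  col-batch : ∀ v → batch v % k ≡ col v
  col-batch v = remainder (row v / k) (col<k v)

  -- Batch g is enumerated by b < k: it occupies column g mod k in the rows k·⌊g/k⌋ + b. Reading the
  -- row modulo k recovers b.
  batch-size : ∀ {g} → g <ℕ n → # fibre batch g ≡ k
  batch-size {g} g<n = ℕₚ.≤-antisym
    (covered⇒∣∣≤ k f covered)
    (injective⇒≤∣∣ k f (λ {x} {z} eq → Finₚ.toℕ-injective
        (trans (sym (index (Finₚ.toℕ<n x))) (trans (cong (λ v → row v % k) eq) (index (Finₚ.toℕ<n z)))))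
      (λ x → ∈-fibre⁺ {f = batch} (inside-batch (Finₚ.toℕ<n x))))
    where
    row< : ∀ {b} → b <ℕ k → (g / k) * k +ℕ b <ℕ n
    row< = bounded {n = j} (DivMod.m<n*o⇒m/o<n {n = j} g<n)
    g%k<k : g % k <ℕ k
    g%k<k = DivMod.m%n<n g k
    f : Fin k → Fin m
    f b = elem (row< (Finₚ.toℕ<n b)) g%k<k
    index : ∀ {b} (b<k : b <ℕ k) → row (elem (row< b<k) g%k<k) % k ≡ b
    index b<k = trans (cong (_% k) (row-elem (row< b<k) g%k<k)) (remainder (g / k) b<k)
    inside-batch : ∀ {b} (b<k : b <ℕ k) → batch (elem (row< b<k) g%k<k) ≡ g
    inside-batch b<k = trans (cong₂ (λ a c → a * k +ℕ c)
      (trans (cong (_/ k) (row-elem (row< b<k) g%k<k)) (quotient (g / k) b<k)) (col-elem (row< b<k) g%k<k)) (recompose g)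
    covered : ∀ {v} → v ∈ₛ fibre batch g → ∃ λ b → f b ≡ v
    covered {v} v∈ with ∈-fibre⁻ {f = batch} v∈
    ... | refl = fromℕ< b<k , elem-unique (row< (Finₚ.toℕ<n (fromℕ< b<k))) g%k<k row≡ (sym (col-batch v))
      where
      b<k : row v % k <ℕ k
      b<k = DivMod.m%n<n (row v) k
      row≡ : row v ≡ (batch v / k) * k +ℕ toℕ (fromℕ< b<k)
      row≡ = trans (sym (recompose (row v))) (sym (cong₂ (λ a c → a * k +ℕ c) (quotient (row v / k) (col<k v)) (Finₚ.toℕ-fromℕ< b<k)))

  batches : List (Subset m)
  batches = List.map (fibre batch) (List.upTo n)

  batches-count : ∀ v → count v batches ≡ 1
  batches-count v = trans (sym (count-map (fibre batch) v (List.upTo n)))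
    (count-unique (λ g → lookup (fibre batch g) v Boolₚ.≟ true) (Uniqueₚ.upTo⁺ n) (∈-upTo⁺ (batch<n v))
      (∈⇒lookup (∈-fibre⁺ {f = batch} refl)) (λ eq → sym (∈-fibre⁻ {f = batch} (lookup⇒∈ eq))))

  -- Cost of the offline solution

  open Optimum 0<k σ times≥0

  -- One common matching time for all batches: it lies within `E` of every late arrival, so only
  -- `p₀` and `q₀` wait substantially longer.
  end : ℚ
  end = D +ℚ ℕtoℚ E

  times≤end : ∀ v → times v ≤ℚ end
  times≤end v with age v
  ... | early _ eq = subst (_≤ℚ end) (sym eq) (+-nonNeg (ℚₚ.<⇒≤ D>0) (0≤ℕtoℚ E))
  ... | late eq = subst (_≤ℚ end) (sym eq) (ℚₚ.+-monoʳ-≤ D (ℕtoℚ-mono-≤ (ℕₚ.^-monoʳ-≤ 3 (ℕₚ.<⇒≤ (row<n v)))))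

  offline : OfflineSolution k σ
  offline = record
    { groups = List.map (λ T → T , end) batches
    ; sizeK = λ T∈ → size (∈-map⁻ _ T∈)
    ; afterArr = λ T∈ v _ → after (∈-map⁻ _ T∈) v
    ; partition = λ v → trans (count-map proj₁ v (List.map (λ T → T , end) batches)) (trans (cong (count v) (strip batches)) (batches-count v)) }
    where
    strip : ∀ Ts → List.map proj₁ (List.map (λ T → T , end) Ts) ≡ Ts
    strip []       = refl
    strip (T ∷ Ts) = cong (T ∷_) (strip Ts)
    size : ∀ {T τ} → ∃[ U ] (U ∈ batches × (T , τ) ≡ (U , end)) → # T ≡ k
    size (U , U∈ , refl) with ∈-map⁻ (fibre batch) U∈
    ... | g , g∈ , refl = batch-size (∈-upTo⁻ g∈)
    after : ∀ {T τ} → ∃[ U ] (U ∈ batches × (T , τ) ≡ (U , end)) → ∀ v → times v ≤ℚ τ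
    after (U , U∈ , refl) v = times≤end v

  same-position : ∀ {T} → T ∈ batches → dD (List.map (pos σ) (elems T)) ≤ℚ 0ℚ
  same-position T∈ with ∈-map⁻ (fibre batch) T∈
  ... | g , _ , refl = dD≤ ℚₚ.≤-refl λ p∈ q∈ → agree (at p∈) (at q∈)
    where
    at : ∀ {p} → p ∈ List.map (pos σ) (elems (fibre batch g)) → p ≡ positions (g % k)
    at p∈ with ∈-map⁻ (pos σ) p∈
    ... | v , v∈ , refl = cong positions (trans (sym (col-batch v)) (cong (_% k) (∈-fibre⁻ {f = batch} (∈-elems⁻ v∈))))
    agree : ∀ {p q x} → p ≡ x → q ≡ x → ∣ p -ℚ q ∣ℚ ≤ℚ 0ℚ
    agree {x = x} refl refl = ℚₚ.≤-reflexive (∣p-p∣≡0 x)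

  -- Charges the extra waiting time D to a single request, which lets one pointwise bound cover
  -- early and late requests alike.
  indicator : Fin m → Fin m → ℚ
  indicator x v = if ⌊ v Fin.≟ x ⌋ then D else 0ℚ

  indicator-self : ∀ x → indicator x x ≡ D
  indicator-self x with x Fin.≟ x
  ... | yes _ = refl
  ... | no ¬p = contradiction refl ¬p

  indicator≥0 : ∀ x v → 0ℚ ≤ℚ indicator x v
  indicator≥0 x v with v Fin.≟ x
  ... | yes _ = ℚₚ.<⇒≤ D>0
  ... | no  _ = ℚₚ.≤-refl

  Σ-indicator : ∀ x → Σ[ allFin m ] indicator x ≡ D
  Σ-indicator x = trans (Σ-single (Uniqueₚ.allFin⁺ m) (∈-allFin x) zero-elsewhere) (indicator-self x)
    where
    zero-elsewhere : ∀ v → v ≢ x → indicator x v ≡ 0ℚ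
    zero-elsewhere v v≢x with v Fin.≟ x
    ... | yes eq = contradiction eq v≢x
    ... | no _   = refl

  -- A late request arrives after D and so waits at most `E`; an early one waits D + `E` and is one
  -- of the two requests charged by the indicators.
  wait≤ : ∀ v → end -ℚ times v ≤ℚ ℕtoℚ E +ℚ (indicator p₀ v +ℚ indicator q₀ v)
  wait≤ v with age v
  ... | late eq = ≤-shift (lem D (ℕtoℚ E) (times v) (indicator p₀ v +ℚ indicator q₀ v))
      (ℚₚ.+-mono-≤ (ℚₚ.<⇒≤ (late>D eq)) (+-nonNeg (indicator≥0 p₀ v) (indicator≥0 q₀ v)))
    where
    lem : ∀ D E t i → ((D +ℚ E) -ℚ t) +ℚ (t +ℚ i) ≡ (E +ℚ i) +ℚ (D +ℚ 0ℚ)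
    lem = solve-∀ ringℚ
  ... | early v≡ eq = subst (_≤ℚ ℕtoℚ E +ℚ (indicator p₀ v +ℚ indicator q₀ v)) (sym (trans (cong (end -ℚ_) eq) (lem D (ℕtoℚ E))))
      (ℚₚ.+-monoʳ-≤ (ℕtoℚ E) (covers (anchorAt-cases (col v))))
    where
    lem : ∀ D E → (D +ℚ E) -ℚ 0ℚ ≡ E +ℚ D
    lem = solve-∀ ringℚ
    covers : anchorAt (col v) ≡ p₀ ⊎ anchorAt (col v) ≡ q₀ → D ≤ℚ indicator p₀ v +ℚ indicator q₀ v
    covers (inj₁ a≡) = subst (_≤ℚ indicator p₀ v +ℚ indicator q₀ v)
      (trans (cong (indicator p₀) (trans v≡ a≡)) (indicator-self p₀)) (x≤x+d (indicator p₀ v) (indicator≥0 q₀ v))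
    covers (inj₂ a≡) = subst₂ _≤ℚ_ (trans (cong (indicator q₀) (trans v≡ a≡)) (indicator-self q₀))
      (ℚₚ.+-comm (indicator q₀ v) (indicator p₀ v)) (x≤x+d (indicator q₀ v) (indicator≥0 p₀ v))

  -- Groups have diameter 0, so all cost is waiting: `m` times `E`, which is D by the choice of
  -- `Dℕ`, plus D for each of the two early requests. The factor 3 becomes the constant 1/3 of the
  -- theorem.
  offline-cost : cost offline ≤ℚ D +ℚ (D +ℚ D)
  offline-cost = begin
    cost offline
      ≤⟨ drop-distance batches same-position ⟩
    Σ[ batches ] (λ T → waiting σ T end)
      ≡⟨ Σ-partition batches batches-count (λ v → end -ℚ times v) ⟩
    Σ[ allFin m ] (λ v → end -ℚ times v)
      ≤⟨ Σ-mono (allFin m) (λ v _ → wait≤ v) ⟩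
    Σ[ allFin m ] (λ v → ℕtoℚ E +ℚ (indicator p₀ v +ℚ indicator q₀ v))
      ≡⟨ Σ-+ (allFin m) (λ _ → ℕtoℚ E) (λ v → indicator p₀ v +ℚ indicator q₀ v) ⟩
    Σ[ allFin m ] (λ _ → ℕtoℚ E) +ℚ Σ[ allFin m ] (λ v → indicator p₀ v +ℚ indicator q₀ v)
      ≡⟨ cong₂ _+ℚ_ waiting-total (trans (Σ-+ (allFin m) (indicator p₀) (indicator q₀)) (cong₂ _+ℚ_ (Σ-indicator p₀) (Σ-indicator q₀))) ⟩
    D +ℚ (D +ℚ D) ∎
    where
    open ℚₚ.≤-Reasoning
    waiting-total : Σ[ allFin m ] (λ _ → ℕtoℚ E) ≡ D
    waiting-total = trans (Σ-const (allFin m) (ℕtoℚ E)) (trans (cong (λ l → ℕtoℚ l *ℚ ℕtoℚ E) (Listₚ.length-tabulate {n = m} (λ v → v)))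
      (trans (sym (ℕtoℚ-* m E)) (sym D≡)))
    drop-distance : ∀ Ts → (∀ {T} → T ∈ Ts → dD (List.map (pos σ) (elems T)) ≤ℚ 0ℚ) →
      matchingCost σ (List.map (λ T → T , end) Ts) ≤ℚ Σ[ Ts ] (λ T → waiting σ T end)
    drop-distance [] _ = ℚₚ.≤-refl
    drop-distance (T ∷ Ts) zero-distance = ℚₚ.+-mono-≤
      (subst (groupCost σ (T , end) ≤ℚ_) (ℚₚ.+-identityˡ (waiting σ T end)) (ℚₚ.+-monoˡ-≤ (waiting σ T end) (zero-distance (here refl))))
      (drop-distance Ts (zero-distance ∘ there))

  -- Only `q₀` arrives as early as `p₀`, and it lies at distance D.
  p₀-alone : ∀ v → v ≢ p₀ → 0ℚ <ℚ ∣ pos σ v -ℚ pos σ p₀ ∣ℚ ⊎ atime σ p₀ <ℚ atime σ v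
  p₀-alone v v≢ with age v
  ... | late eq = inj₂ (subst (_<ℚ times v) (sym times-p₀) (ℚₚ.<-trans D>0 (late>D eq)))
  ... | early v≡ _ = inj₁ (away (anchorAt-cases (col v)))
    where
    away : anchorAt (col v) ≡ p₀ ⊎ anchorAt (col v) ≡ q₀ → 0ℚ <ℚ ∣ pos σ v -ℚ pos σ p₀ ∣ℚ
    away (inj₁ a≡) = contradiction (trans v≡ a≡) v≢
    away (inj₂ a≡) = subst (0ℚ <ℚ_) (sym (trans (cong₂ (λ x z → ∣ x -ℚ z ∣ℚ) (trans (cong (pos σ) (trans v≡ a≡)) pos-q₀) pos-p₀) ∣D-0∣)) D>0

  -- The competitive ratio

  ⅓ : ℚ
  ⅓ = recipℕ 3

  ratio : ∀ {opt} → opt ≤ℚ D +ℚ (D +ℚ D) → (⅓ *ℚ (ℕtoℚ m *ℚ recipℕ k)) *ℚ opt ≤ℚ ℕtoℚ n *ℚ D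
  ratio {opt} opt≤ = begin
    (⅓ *ℚ (ℕtoℚ m *ℚ recipℕ k)) *ℚ opt
      ≡⟨ cong (λ x → (⅓ *ℚ x) *ℚ opt) m/k≡n ⟩
    (⅓ *ℚ ℕtoℚ n) *ℚ opt
      ≤⟨ *-monoˡ-≤ (*-nonNeg (ℚₚ.<⇒≤ (recipℕ-pos {3} (s≤s z≤n))) (0≤ℕtoℚ n)) opt≤ ⟩
    (⅓ *ℚ ℕtoℚ n) *ℚ (D +ℚ (D +ℚ D))
      ≡⟨ lem ⅓ (ℕtoℚ n) D ⟩
    -- The sum of the three thirds evaluates to `1ℚ`, so only the unit law remains.
    (⅓ +ℚ (⅓ +ℚ ⅓)) *ℚ (ℕtoℚ n *ℚ D)
      ≡⟨ ℚₚ.*-identityˡ (ℕtoℚ n *ℚ D) ⟩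
    ℕtoℚ n *ℚ D ∎
    where
    open ℚₚ.≤-Reasoning
    lem : ∀ c n D → (c *ℚ n) *ℚ (D +ℚ (D +ℚ D)) ≡ (c +ℚ (c +ℚ c)) *ℚ (n *ℚ D)
    lem = solve-∀ ringℚ
    m/k≡n : ℕtoℚ m *ℚ recipℕ k ≡ ℕtoℚ n
    m/k≡n = trans (cong (_*ℚ recipℕ k) (trans (cong ℕtoℚ m≡n*k) (ℕtoℚ-* n k)))
      (trans (ℚₚ.*-assoc (ℕtoℚ n) (ℕtoℚ k) (recipℕ k)) (trans (cong (ℕtoℚ n *ℚ_) (ℕtoℚ*recipℕ 0<k)) (ℚₚ.*-identityʳ (ℕtoℚ n))))

  competitive-gap : ∃[ opt ] (IsOPT k σ opt × 0ℚ <ℚ opt × (∃[ s ] GDk.FinalState k σ s)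
    × (∀ s → GDk.FinalState k σ s → (⅓ *ℚ (ℕtoℚ m *ℚ recipℕ k)) *ℚ opt ≤ℚ GDk.algCost k σ s))
  competitive-gap = with-opt (opt-exists offline)
    where
    with-opt : ∃[ opt ] IsOPT k σ opt → _
    with-opt (opt , isOpt) = opt , isOpt , opt>0 k≥2 p₀ p₀-alone isOpt
      , Rows.final-state-exists k≥2 rowInstance r r>0 threshold≡
      , λ s final → ℚₚ.≤-trans (ratio (ℚₚ.≤-trans (proj₂ isOpt offline) offline-cost))
          (Rows.algCost≥ k≥2 rowInstance r r>0 threshold≡ n m≡n*k s final)

theorem4 : ∃[ c ] (0ℚ <ℚ c × (∀ (k j : ℕ) → 2 ≤ k → 1 ≤ j →
    Σ (Instance (j * (k * k))) λ σ → ∃[ opt ] (IsOPT k σ opt × 0ℚ <ℚ opt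
    × (∃[ s ] GDk.FinalState k σ s)
    × (∀ s → GDk.FinalState k σ s →
    (c *ℚ (ℕtoℚ (j * (k * k)) *ℚ recipℕ k)) *ℚ opt ≤ℚ GDk.algCost k σ s))))
theorem4 = recipℕ 3 , recipℕ-pos {3} (s≤s z≤n) , λ k j k≥2 j≥1 →
  Concrete.σ j k k≥2 j≥1 , Concrete.competitive-gap j k k≥2 j≥1
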